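{- For every $n\geq 1$, the $S_\infty$-space $\mathrm{Mod}_\omega(\widehat{\mathcal{B}_n})$ is $(n-1)$-dimensional and locally generically $(n-1)$-dimensional.
   Context: BKL$_n$-structures. For $n\ge1$, $\mathcal{L}_n$ is the language with $n$-ary function symbols $s_i$ ($i\in\omega$) and $n$-ary relation symbols $R_j$ ($j\in\omega$). A BKL$_n$-structure is an $\mathcal{L}_n$-structure $A$ (possibly empty) such that: (B1) the relations $(R_j)_{j\in\omega}$ partition $A^n$; (B2) if $a=(a_0,\dots,a_{n-1})$ satisfies $R_j$, then $s_i(a)=a_0$ for all $i>j$; (B3) for every $B\subseteq A$ with $|B|=n+1$ there is $b\in B$ lying in the substructure generated by $B\setminus\{b\}$; (B4) $A$ is locally finite, i.e. every finitely generated substructure is finite. $\mathcal{B}_n$ is the class of all BKL$_n$-structures. Labeled structures. For a countable language $\mathcal{L}$, let $\widehat{\mathcal{L}}=\mathcal{L}\cup\{P_i\mid i\in\omega\}$ with $P_i$ new unary relation symbols. For a class $\mathcal{K}$ of $\mathcal{L}$-structures, $\widehat{\mathcal{K}}$ is the class of $\widehat{\mathcal{L}}$-structures whose reduct to $\mathcal{L}$ is in $\mathcal{K}$ and in which no two distinct elements satisfy exactly the same predicates $P_i$. Spaces of structures. $\mathcal{X}_{\mathcal{L}}$ is the Polish space of all $\mathcal{L}$-structures with domain $\omega$, with subbasis the sets $\{A\mid A\models R(a)\}$, $\{A\mid A\models\lnot R(a)\}$, $\{A\mid A\models f(a)=b\}$, for $R,f$ relation and function symbols of $\mathcal{L}$,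 $a$ a tuple from $\omega$ of the right length and $b\in\omega$. $S_\infty$ is the Polish group of all bijections of $\omega$ with the pointwise convergence topology; it acts continuously on $\mathcal{X}_{\mathcal{L}}$ by the logic action: $gA=B$ iff $g$ is an isomorphism $A\to B$. $\mathrm{Mod}_\omega(\mathcal{K})$ is the subspace of structures in $\mathcal{X}_{\mathcal{L}}$ belonging to $\mathcal{K}$. $\mathrm{Mod}_\omega(\widehat{\mathcal{B}_n})$ is an invariant $G_\delta$ subspace of $\mathcal{X}_{\widehat{\mathcal{L}_n}}$, hence a Polish $S_\infty$-space. Becker digraph. A sequence $(g_n)$ in a Polish group $G$ is right-Cauchy if it is Cauchy for some (equivalently, any) compatible right-invariant metric. In a Polish $G$-space $X$, $x$ right-embeds in $x'$ if there is a right-Cauchy sequence $(g_n)$ in $G$ with $g_nx'\to x$. For $G$-invariant $C\subseteq X$, $\mathcal{B}(C/G)$ is the digraph whose vertices are the orbits $[x]$, $x\in C$, with an arrow $[x]\to[x']$ iff $x$ right-embeds in $x'$. Dimension. The combinatorial $m$-cube ($m\ge 0$) is the digraph on the powerset of $\{0,\dots,m-1\}$ with an arrow $\sigma\to\tau$ iff $\sigma\subseteq\tau$. A digraph embedding is an injection that preserves and reflects arrows. For a non-empty $G$-invariant $C\subseteq X$, the dimension of $C$ is the largest $m\geq0$ such that the combinatorial $m$-cube embeds in $\mathcal{B}(C/G)$ if such a largest $m$ exists, and $\infty$ otherwise. $X$ is $m$-dimensional if its dimension is $m$. $X$ is locally generically $m$-dimensional if $m$ is the largest element of $\{0,1,\dots\}\cup\{\infty\}$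 such that every invariant non-meager subset of $X$ with the Baire property has dimension at least $m$. -}

module Defs where

open import Data.Bool.Base using (Bool; T)
open import Data.Fin.Base using (Fin)
open import Data.Fin.Subset using (Subset) renaming (_⊆_ to _⊆ˢ_)
open import Data.List.Base as List using (List)
open import Data.List.Membership.Propositional using () renaming (_∈_ to _∈ˡ_)
open import Data.List.Membership.Propositional.Properties using (∈-map⁺)
import Data.List.Relation.Unary.All as ListAll
open import Data.Nat.Base using (ℕ; suc; NonZero; _≤_; _≥_; _>_)
open import Data.Product using (Σ; ∃; ∃!; _×_; _,_; proj₁; proj₂)
open import Data.Rational.Base as ℚ using (ℚ; 0ℚ)
open import Data.Sum.Base using (_⊎_; inj₁; inj₂; [_,_]′)
open import Data.Vec.Base as Vec using (Vec; []; _∷_)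
open import Data.Vec.Properties using (map-∘; map-cong; map-id)
open import Data.Vec.Relation.Unary.All using (All; []; _∷_)
open import Function.Base using (_∘_; const)
open import Function.Bundles using (_↔_; _⇔_; module Inverse)
open import Function.Construct.Composition using (_↔-∘_)
open import Function.Definitions using (Injective)
open import Level using (0ℓ; _⊔_) renaming (suc to lsuc)
open import Relation.Binary.Construct.Add.Supremum.NonStrict _≤_ using (_≤⁺_)
open import Relation.Binary.Core using (Rel)
open import Relation.Binary.Morphism.Structures using (IsOrderMonomorphism)
open import Relation.Binary.PropositionalEquality
  using (_≡_; _≢_; refl; sym; trans; cong; subst)
open import Relation.Nullary.Construct.Add.Supremum using (_⁺; [_]; ⊤⁺)
open import Relation.Nullary.Negation using (¬_)
open import Relation.Unary
  using (Pred; _∈_; _⊆_; _≬_; _∪_; _∖_; ⋃; Empty; Satisfiable; U)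

record Language : Set₁ where
  field
    FunSym   : Set
    RelSym   : Set
    funArity : FunSym → ℕ
    relArity : RelSym → ℕ

open Language

record Structure (L : Language) (A : Set) : Set where
  field
    fun : (f : FunSym L) → Vec A (funArity L f) → A
    rel : (R : RelSym L) → Vec A (relArity L R) → Bool

open Structure public using (fun; rel)

infix 4 _⊨_⟨_⟩
_⊨_⟨_⟩ : ∀ {L A} → Structure L A → (R : RelSym L) → Vec A (relArity L R) → Set
M ⊨ R ⟨ as ⟩ = T (rel M R as)

Class : Language → Set₁
Class L = ∀ {A : Set} → Structure L A → Set

-- The underlying set of the substructure generated by S.
data Generated {L A} (M : Structure L A) (S : Pred A 0ℓ) : Pred A 0ℓ where
  gen : ∀ {a} → a ∈ S → Generated M S a
  app : ∀ f {as} → All (Generated M S) as → Generated M S (fun M f as)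

ℒ : ℕ → Language
ℒ n = record { FunSym = ℕ ; RelSym = ℕ ; funArity = const n ; relArity = const n }

first : ∀ {A : Set} {n} .{{_ : NonZero n}} → Vec A n → A
first {n = suc _} (a ∷ _) = a

record IsBKL (n : ℕ) .{{_ : NonZero n}} {A : Set} (M : Structure (ℒ n) A) : Set where
  field
    -- Blocks of the partition may be empty.
    partition : ∀ as → ∃! _≡_ (λ j → M ⊨ j ⟨ as ⟩)
    trivial   : ∀ {i j} as → M ⊨ j ⟨ as ⟩ → i > j → fun M i as ≡ first as
    -- A subset of size n + 1 is given by an injective enumeration b.
    dependent : (b : Fin (suc n) → A) → Injective _≡_ _≡_ b →
                ∃ λ i → Generated M (λ a → ∃ λ j → j ≢ i × b j ≡ a) (b i)
    locallyFinite : (as : List A) →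
                    ∃ λ (bs : List A) → Generated M (_∈ˡ as) ⊆ (_∈ˡ bs)

𝓑 : (n : ℕ) .{{_ : NonZero n}} → Class (ℒ n)
𝓑 n = IsBKL n

hat : Language → Language
hat L = record
  { FunSym   = FunSym L
  ; RelSym   = RelSym L ⊎ ℕ
  ; funArity = funArity L
  ; relArity = [ relArity L , const 1 ]′
  }

reduct : ∀ {L A} → Structure (hat L) A → Structure L A
reduct M = record { fun = fun M ; rel = rel M ∘ inj₁ }

label : ∀ {L A} → Structure (hat L) A → A → ℕ → Bool
label M a i = rel M (inj₂ i) (a ∷ [])

Labeled : ∀ {L} → Class L → Class (hat L)
Labeled K M = K (reduct M) × (∀ a b → (∀ i → label M a i ≡ label M b i) → a ≡ b)

record Space : Set₁ where
  field
    Point    : Set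
    Index    : Set
    subbasic : Index → Pred Point 0ℓ

  basic : List Index → Pred Point 0ℓ
  basic is x = ListAll.All (λ i → x ∈ subbasic i) is

  IsOpen : Pred Point 0ℓ → Set
  IsOpen V = ∀ {x} → x ∈ V → ∃ λ is → x ∈ basic is × basic is ⊆ V

  _⟶_ : (ℕ → Point) → Point → Set₁
  s ⟶ x = ∀ V → IsOpen V → x ∈ V → ∃ λ N → ∀ n → n ≥ N → s n ∈ V

  Closure : Pred Point 0ℓ → Pred Point (lsuc 0ℓ)
  Closure S x = ∀ V → IsOpen V → x ∈ V → S ≬ V

  NowhereDense : Pred Point 0ℓ → Set₁
  NowhereDense S = ∀ V → IsOpen V → V ⊆ Closure S → Empty V

  Meager : Pred Point 0ℓ → Set₁
  Meager S = ∃ λ (N : ℕ → Pred Point 0ℓ) → (∀ k → NowhereDense (N k)) × S ⊆ ⋃ ℕ N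

  BaireProperty : Pred Point 0ℓ → Set₁
  BaireProperty S = ∃ λ V → IsOpen V × Meager ((S ∖ V) ∪ (V ∖ S))

subspace : (X : Space) → Pred (Space.Point X) 0ℓ → Space
subspace X S = record
  { Point    = Σ (Space.Point X) S
  ; Index    = Space.Index X
  ; subbasic = λ i → Space.subbasic X i ∘ proj₁
  }

S∞ : Set
S∞ = ℕ ↔ ℕ

open Inverse using (to; from; strictlyInverseˡ; strictlyInverseʳ)

S∞-space : Space
S∞-space = record
  { Point    = S∞
  ; Index    = ℕ × ℕ
  ; subbasic = λ (a , b) g → to g a ≡ b
  }

-- A real-valued distance d is represented by its upper cuts: d g h q means
-- that the distance from g to h is less than q.
Distance : Set₁
Distance = S∞ → S∞ → Pred ℚ 0ℓ

record IsMetric (d : Distance) : Set where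
  field
    -- Each d g h is the upper cut of a nonnegative real.
    inhabited : ∀ g h → ∃ (d g h)
    positive  : ∀ {g h q} → d g h q → 0ℚ ℚ.< q
    upward    : ∀ {g h p q} → d g h p → p ℚ.< q → d g h q
    rounded   : ∀ {g h q} → d g h q → ∃ λ p → p ℚ.< q × d g h p

    identity  : ∀ g h → (∀ q → 0ℚ ℚ.< q → d g h q) ⇔ (∀ a → to g a ≡ to h a)
    symmetric : ∀ {g h q} → d g h q → d h g q
    triangle  : ∀ {f g h p q} → d f g p → d g h q → d f h (p ℚ.+ q)

Compatible : Distance → Set₁
Compatible d = ∀ V → Space.IsOpen S∞-space V ⇔
  (∀ {g} → g ∈ V → ∃ λ ε → 0ℚ ℚ.< ε × (∀ {h} → d g h ε → h ∈ V))

-- (g ↔-∘ f) applies f first, so that it is the group product g f.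
RightInvariant : Distance → Set
RightInvariant d = ∀ f g h q → d g h q ⇔ d (g ↔-∘ f) (h ↔-∘ f) q

Cauchy : Distance → (ℕ → S∞) → Set
Cauchy d g = ∀ ε → 0ℚ ℚ.< ε →
             ∃ λ N → ∀ m n → m ≥ N → n ≥ N → d (g m) (g n) ε

RightCauchy : (ℕ → S∞) → Set₁
RightCauchy g = ∃ λ d →
  IsMetric d × Compatible d × RightInvariant d × Cauchy d g

record Digraph a ℓ₁ ℓ₂ : Set (lsuc (a ⊔ ℓ₁ ⊔ ℓ₂)) where
  field
    Vertex : Set a
    _≈_    : Rel Vertex ℓ₁
    _⇒_    : Rel Vertex ℓ₂

-- Arrows are preserved by an order homomorphism (in the library's sense,
-- which does not require an order) and reflected by a monomorphism.
_EmbedsIn_ : ∀ {a ℓ₁ ℓ₂ b ℓ₃ ℓ₄} →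
             Digraph a ℓ₁ ℓ₂ → Digraph b ℓ₃ ℓ₄ → Set (a ⊔ ℓ₁ ⊔ ℓ₂ ⊔ b ⊔ ℓ₃ ⊔ ℓ₄)
D EmbedsIn E = ∃ (IsOrderMonomorphism D._≈_ E._≈_ D._⇒_ E._⇒_)
  where
  module D = Digraph D
  module E = Digraph E

cube : ℕ → Digraph 0ℓ 0ℓ 0ℓ
cube m = record { Vertex = Subset m ; _≈_ = _≡_ ; _⇒_ = _⊆ˢ_ }

-- The data of an S∞-space. Equality of points is a relation because
-- structures are compared pointwise.
record RawS∞Space : Set₁ where
  infix  4 _≈_
  infixr 7 _·_
  field
    space : Space
  open Space space public
  field
    _≈_ : Rel Point 0ℓ
    _·_ : S∞ → Point → Point

  SameOrbit : Rel Point 0ℓ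
  SameOrbit x y = ∃ λ g → g · x ≈ y

  Invariant : Pred Point 0ℓ → Set
  Invariant C = ∀ {x y} → SameOrbit x y → x ∈ C → y ∈ C

  RightEmbeds : Rel Point (lsuc 0ℓ)
  RightEmbeds x x′ = ∃ λ (g : ℕ → S∞) → RightCauchy g × ((λ n → g n · x′) ⟶ x)

  -- An orbit is represented by any of its points.
  becker : Pred Point 0ℓ → Digraph 0ℓ 0ℓ (lsuc 0ℓ)
  becker C = record
    { Vertex = Σ Point C
    ; _≈_    = λ x y → SameOrbit (proj₁ x) (proj₁ y)
    ; _⇒_    = λ x y → RightEmbeds (proj₁ x) (proj₁ y)
    }

  LargestCube : Pred Point 0ℓ → ℕ → Set₁
  LargestCube C m = cube m EmbedsIn becker C ×
                    (∀ k → cube k EmbedsIn becker C → k ≤ m)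

  -- ⊤⁺ plays the role of ∞.
  HasDimension : Pred Point 0ℓ → ℕ ⁺ → Set₁
  HasDimension C [ m ] = Satisfiable C × LargestCube C m
  HasDimension C ⊤⁺    = Satisfiable C × ¬ ∃ (LargestCube C)

  Dimensional : ℕ ⁺ → Set₁
  Dimensional = HasDimension U

  LocallyAtLeast : ℕ ⁺ → Set₁
  LocallyAtLeast m = ∀ C → Invariant C → ¬ Meager C → BaireProperty C →
                     ∃ λ d → HasDimension C d × m ≤⁺ d

  LocallyGenericallyDimensional : ℕ ⁺ → Set₁
  LocallyGenericallyDimensional m =
    LocallyAtLeast m × (∀ k → LocallyAtLeast k → k ≤⁺ m)

data StructureIndex (L : Language) : Set where
  holds fails : (R : RelSym L) → Vec ℕ (relArity L R) → StructureIndex L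
  value       : (f : FunSym L) → Vec ℕ (funArity L f) → ℕ → StructureIndex L

𝓧 : Language → Space
𝓧 L = record
  { Point    = Structure L ℕ
  ; Index    = StructureIndex L
  ; subbasic = λ where
      (holds R as)   M → M ⊨ R ⟨ as ⟩
      (fails R as)   M → ¬ M ⊨ R ⟨ as ⟩
      (value f as b) M → fun M f as ≡ b
  }

infix 4 _≈ˢ_
_≈ˢ_ : ∀ {L A} → Structure L A → Structure L A → Set
M ≈ˢ N = (∀ f as → fun M f as ≡ fun N f as) × (∀ R as → rel M R as ≡ rel N R as)

-- The unique structure for which g is an isomorphism from M.
infixr 7 _·ˢ_
_·ˢ_ : ∀ {L} → S∞ → Structure L ℕ → Structure L ℕ
g ·ˢ M = record
  { fun = λ f as → to g (fun M f (Vec.map (from g) as))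
  ; rel = λ R as → rel M R (Vec.map (from g) as)
  }

IsomorphismInvariant : ∀ {L} → Class L → Set
IsomorphismInvariant {L} K = ∀ g {M : Structure L ℕ} → K M → K (g ·ˢ M)

Mod : ∀ {L} (K : Class L) → IsomorphismInvariant K → RawS∞Space
Mod {L} K inv = record
  { space = subspace (𝓧 L) K
  ; _≈_   = λ M N → proj₁ M ≈ˢ proj₁ N
  ; _·_   = λ g (M , M∈K) → g ·ˢ M , inv g M∈K
  }

from-injective : (g : S∞) → Injective _≡_ _≡_ (from g)
from-injective g {x} {y} eq =
  trans (sym (strictlyInverseˡ g x)) (trans (cong (to g) eq) (strictlyInverseˡ g y))

map-from-to : (g : S∞) → ∀ {n} (as : Vec ℕ n) → Vec.map (from g) (Vec.map (to g) as) ≡ as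
map-from-to g as = trans (sym (map-∘ (from g) (to g) as))
  (trans (map-cong (strictlyInverseʳ g) as) (map-id as))

module _ {L : Language} (g : S∞) (M : Structure L ℕ) where

  module _ {S S′ : Pred ℕ 0ℓ} (S→S′ : ∀ {a} → a ∈ S → to g a ∈ S′) where

    Generated-to : ∀ {a} → Generated M S a → Generated (g ·ˢ M) S′ (to g a)
    All-to : ∀ {n} {as : Vec ℕ n} →
             All (Generated M S) as → All (Generated (g ·ˢ M) S′) (Vec.map (to g) as)

    Generated-to (gen a∈S) = gen (S→S′ a∈S)
    Generated-to (app f {as} ps) =
      subst (λ bs → Generated (g ·ˢ M) S′ (to g (fun M f bs)))
            (map-from-to g as) (app f (All-to ps))

    All-to []       = []
    All-to (p ∷ ps) = Generated-to p ∷ All-to ps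

  module _ {S S′ : Pred ℕ 0ℓ} (S′→S : ∀ {a} → a ∈ S′ → from g a ∈ S) where

    Generated-from : ∀ {a} → Generated (g ·ˢ M) S′ a → Generated M S (from g a)
    All-from : ∀ {n} {as : Vec ℕ n} →
               All (Generated (g ·ˢ M) S′) as → All (Generated M S) (Vec.map (from g) as)

    Generated-from (gen a∈S′) = gen (S′→S a∈S′)
    Generated-from (app f ps) =
      subst (Generated M S) (sym (strictlyInverseʳ g _)) (app f (All-from ps))

    All-from []       = []
    All-from (p ∷ ps) = Generated-from p ∷ All-from ps

first-map : ∀ {n} .{{_ : NonZero n}} (h : ℕ → ℕ) (as : Vec ℕ n) →
            first (Vec.map h as) ≡ h (first as)
first-map {suc _} h (_ ∷ _) = refl

𝓑-invariant : ∀ n .{{_ : NonZero n}} → IsomorphismInvariant (𝓑 n)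
𝓑-invariant n g {M} bkl = record
  { partition     = λ as → partition (Vec.map (from g) as)
  ; trivial       = λ as r i>j → trans
      (cong (to g) (trans (trivial (Vec.map (from g) as) r i>j) (first-map (from g) as)))
      (strictlyInverseˡ g (first as))
  ; dependent     = λ b b-inj →
      let i , p = dependent (from g ∘ b) (b-inj ∘ from-injective g) in
      i , subst (Generated (g ·ˢ M) _) (strictlyInverseˡ g (b i))
            (Generated-to g M
              (λ (j , j≢i , eq) →
                j , j≢i , trans (sym (strictlyInverseˡ g (b j))) (cong (to g) eq))
              p)
  ; locallyFinite = λ as →
      let bs , sub = locallyFinite (List.map (from g) as) in
      List.map (to g) bs , λ {a} p →
        subst (_∈ˡ _) (strictlyInverseˡ g a)
          (∈-map⁺ (to g) (sub (Generated-from g M (∈-map⁺ (from g)) p)))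
  }
  where open IsBKL bkl

Labeled-invariant : ∀ {L} (K : Class L) →
                    IsomorphismInvariant K → IsomorphismInvariant (Labeled K)
Labeled-invariant K inv g {M} (M∈K , distinct) =
  inv g M∈K , λ a b same → from-injective g (distinct (from g a) (from g b) same)

Mod-𝓑̂ : (n : ℕ) .{{_ : NonZero n}} → RawS∞Space
Mod-𝓑̂ n = Mod (Labeled (𝓑 n)) (Labeled-invariant (𝓑 n) (𝓑-invariant n))

{-# OPTIONS --safe #-}
module Submission where

open import Defs
open import Axiom.ExcludedMiddle using (ExcludedMiddle)
open import Data.Bool.Base using (Bool; true; false; T)
open import Data.Bool.Properties using (T-≡)
import Data.Empty as Empty
open import Data.Fin.Base using (Fin; zero; suc; toℕ; fromℕ<; inject≤; punchIn; punchOut)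
import Data.Fin.Properties as Fin
open import Data.Fin.Subset using (Subset; ⊤; ⊥; ⁅_⁆; ∁; inside; outside)
  renaming (_⊆_ to _⊆ˢ_; _∈_ to _∈ˢ_)
open import Data.Fin.Subset.Properties
  using (⊆-min; ⊆-max; ⊆-antisym; x∈⁅x⁆; x∈⁅y⁆⇒x≡y; x∉p⇒x∈∁p; x∈p⇒x∉∁p)
import Data.Integer.Base as ℤ
import Data.Integer.Properties as ℤ
open import Data.List.Base as List using (List; []; _∷_; _++_; upTo)
open import Data.List.Membership.Propositional using () renaming (_∈_ to _∈ˡ_)
open import Data.List.Membership.Propositional.Properties using (∈-tabulate⁺; ∈-upTo⁺)
import Data.List.Relation.Unary.All as ListAll
open import Data.List.Relation.Unary.All using () renaming ([] to []ˡ; _∷_ to _∷ˡ_)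
open import Data.List.Relation.Unary.All.Properties using (++⁺; ++⁻)
open import Data.List.Relation.Unary.Any using (here; there)
open import Data.Nat.Base
open import Data.Nat.Coprimality using (1-coprimeTo)
open import Data.Nat.Properties
open import Data.Product using (∃; _×_; _,_; proj₁; proj₂)
open import Data.Rational.Base as ℚ using (ℚ; mkℚ; 0ℚ; 1ℚ; ½)
import Data.Rational.Properties as ℚ
open import Data.Sum.Base using (_⊎_; inj₁; inj₂)
open import Data.Vec.Base as Vec using (Vec; []; _∷_)
open import Data.Vec.Properties using (map-∘; map-id; ∷-injective)
open import Data.Vec.Relation.Binary.Pointwise.Inductive
  using (Pointwise; []; _∷_; Pointwise-≡⇒≡)
open import Data.Vec.Relation.Unary.All as All using (All; []; _∷_)
open import Data.Vec.Relation.Unary.All.Properties using (map⁺; map⁻; tabulate⁺; tabulate⁻)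
open import Function.Base using (_∘_; id)
open import Function.Bundles using (mk⇔; mk↔ₛ′; module Inverse; module Equivalence)
open import Function.Construct.Composition using (_↔-∘_)
open import Function.Construct.Identity using (↔-id)
open import Function.Construct.Symmetry using (↔-sym)
open import Function.Definitions using (Injective)
open import Level using (0ℓ; Lift; lift; lower) renaming (suc to lsuc)
open import Relation.Binary.Construct.Add.Supremum.NonStrict _≤_ using (_≤⁺_; [_])
open import Relation.Binary.Morphism.Structures using (IsOrderMonomorphism)
open import Relation.Binary.PropositionalEquality
open import Relation.Nullary using (Dec; yes; no; ¬_; contradiction)
open import Relation.Nullary.Construct.Add.Supremum using ([_]; ⊤⁺)
open import Relation.Nullary.Decidable using (map′; decidable-stable)
open import Relation.Unary using (Pred; _∈_; _⊆_; _∩_; _≬_; U)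

-- A right-Cauchy sequence in S∞ is one whose inverses converge pointwise, to an
-- injection; hence x right-embeds in x′ iff x embeds in x′ as a structure. In labeled
-- structures such an embedding is unique, so below a point the Becker digraph is the
-- poset of infinite substructures of that point.
--
-- Upper bound: an n-cube in it would give n elements b i, the i-th outside the
-- substructure of ∁ ⁅ i ⁆, and by local finiteness an element of the substructure of ⊥
-- outside the span of the b i; these n + 1 elements contradict (B3).
--
-- Lower bound: given countably many nowhere dense sets, we build an increasing sequence
-- of finite structures whose elements carry supports in Subset (n − 1), those with
-- support inside σ forming a substructure M σ together with an enumeration. The
-- nowhere dense sets are avoided by the enumerated M σ one after the other, each time
-- extending M σ and amalgamating the extension with the rest. In the amalgam (B3)
-- survives because a mixed set of n + 1 elements has a member that is redundant for
-- the union of the n − 1 coordinates of the supports. In the limit σ ↦ M σ is an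
-- (n − 1)-cube avoiding all the given sets. This also shows that the whole space is
-- non-meager.

open Language
open Inverse using (to; from; strictlyInverseˡ; strictlyInverseʳ)

-- Neighbourhoods in a space given by a subbasis

module Neighbourhoods (X : Space) where
  open Space X

  Nbhd : Point → Pred Point 0ℓ → Set
  Nbhd x P = ∃ λ is → x ∈ basic is × basic is ⊆ P

  subbasic-nbhd : ∀ {x} i → x ∈ subbasic i → Nbhd x (subbasic i)
  subbasic-nbhd i x∈i = i ∷ [] , x∈i ∷ˡ []ˡ , λ { (y∈i ∷ˡ _) → y∈i }

  nbhd-⊆ : ∀ {x P Q} → P ⊆ Q → Nbhd x P → Nbhd x Q
  nbhd-⊆ P⊆Q (is , x∈is , is⊆P) = is , x∈is , P⊆Q ∘ is⊆P

  nbhd-∩ : ∀ {x P Q} → Nbhd x P → Nbhd x Q → Nbhd x (P ∩ Q)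
  nbhd-∩ (is , x∈is , is⊆P) (js , x∈js , js⊆Q) =
    is ++ js , ++⁺ x∈is x∈js ,
    λ y∈ → let y∈is , y∈js = ++⁻ is y∈ in is⊆P y∈is , js⊆Q y∈js

  nbhd-⋂< : ∀ {x} k {P : ℕ → Pred Point 0ℓ} → (∀ i → i < k → Nbhd x (P i)) →
            Nbhd x (λ y → ∀ i → i < k → P i y)
  nbhd-⋂< zero    nb = [] , []ˡ , λ _ i ()
  nbhd-⋂< (suc k) {P} nb =
    nbhd-⊆ glue (nbhd-∩ (nb k ≤-refl) (nbhd-⋂< k (λ i i<k → nb i (m<n⇒m<1+n i<k))))
    where
    glue : ∀ {y} → P k y × (∀ i → i < k → P i y) → ∀ i → i < suc k → P i y
    glue (pk , p) i i<1+k with m<1+n⇒m<n∨m≡n i<1+k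
    ... | inj₁ i<k  = p i i<k
    ... | inj₂ refl = pk

  nbhd-⋂Vec : ∀ {x} k n {P : Vec ℕ n → Pred Point 0ℓ} →
              (∀ as → All (_< k) as → Nbhd x (P as)) →
              Nbhd x (λ y → ∀ as → All (_< k) as → P as y)
  nbhd-⋂Vec k zero    nb = nbhd-⊆ (λ { p [] [] → p }) (nb [] [])
  nbhd-⋂Vec k (suc n) nb =
    nbhd-⊆ (λ { p (a ∷ as) (a<k ∷ as<k) → p a a<k as as<k })
      (nbhd-⋂< k (λ a a<k → nbhd-⋂Vec k n (λ as as<k → nb (a ∷ as) (a<k ∷ as<k))))

  subbasic-open : ∀ i → IsOpen (subbasic i)
  subbasic-open i = subbasic-nbhd i

  basic-open : ∀ is → IsOpen (basic is)
  basic-open is x∈is = is , x∈is , id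

  eventually-basic : ∀ {s : ℕ → Point} is →
    ListAll.All (λ i → ∃ λ N → ∀ n → n ≥ N → s n ∈ subbasic i) is →
    ∃ λ N → ∀ n → n ≥ N → s n ∈ basic is
  eventually-basic []       []ˡ             = 0 , λ _ _ → []ˡ
  eventually-basic (i ∷ is) ((N , p) ∷ˡ ps) =
    let N′ , p′ = eventually-basic is ps in
    N ⊔ N′ , λ n n≥ → p n (m⊔n≤o⇒m≤o N N′ n≥) ∷ˡ p′ n (m⊔n≤o⇒n≤o N N′ n≥)

-- Right embeddings are embeddings of structures

-- The rational 1 / (k + 1): `mkℚ` takes the denominator minus one.
unit : ℕ → ℚ
unit k = mkℚ (ℤ.+ 1) k (1-coprimeTo _)

unit-positive : ∀ k → 0ℚ ℚ.< unit k
unit-positive k = ℚ.positive⁻¹ (unit k)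

unit-archimedean : ∀ {q} → 0ℚ ℚ.< q → ∃ λ k → unit k ℚ.< q
unit-archimedean {mkℚ (ℤ.+ zero) d _} (ℚ.*<* (ℤ.+<+ ()))
-- Here q is (p + 1) / (d + 1), and d + 1 < d + 2 ≤ (p + 1)(d + 2) gives 1 / (d + 2) < q.
unit-archimedean {mkℚ (ℤ.+ suc p) d _} _ = suc d , ℚ.*<*
  (subst₂ ℤ._<_ (cong ℤ.+_ (sym (*-identityˡ (suc d)))) (ℤ.pos-* (suc p) (suc (suc d)))
    (ℤ.+<+ (<-≤-trans (n<1+n (suc d)) (m≤m+n (suc (suc d)) (p * suc (suc d))))))
unit-archimedean {mkℚ ℤ.-[1+ p ] d _} (ℚ.*<* ())

unit-reflects-< : ∀ {j k} → unit j ℚ.< unit k → k < j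
unit-reflects-< {j} {k} (ℚ.*<* lt) =
  s<s⁻¹ (ℤ.drop‿+<+ (subst₂ ℤ._<_ (ℤ.*-identityˡ (ℤ.+ suc k)) (ℤ.*-identityˡ (ℤ.+ suc j)) lt))

AgreeBelow : ℕ → S∞ → S∞ → Set
AgreeBelow k g h = ∀ i → i < k → from g i ≡ from h i

-- The right-invariant distance 1 / (k + 1), where k is the first place at which
-- the inverses of g and h differ.
dist : Distance
dist g h q = ∃ λ k → unit k ℚ.< q × AgreeBelow k g h

dist-isMetric : IsMetric dist
dist-isMetric = record
  { inhabited = λ g h → let q , u<q = larger in q , 0 , u<q , λ _ ()
  ; positive  = λ (k , u<q , _) → ℚ.<-trans (unit-positive k) u<q
  ; upward    = λ (k , u<p , ag) p<q → k , ℚ.<-trans u<p p<q , ag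
  ; rounded   = λ (k , u<q , ag) →
      let p , u<p , p<q = ℚ.<-dense u<q in p , p<q , k , u<p , ag
  ; identity  = λ g h → mk⇔ (λ close → from≡⇒to≡ g h (close⇒from≡ {g} {h} close))
      (λ eq q 0<q → let k , u<q = unit-archimedean 0<q in k , u<q , λ i _ → to≡⇒from≡ g h eq i)
  ; symmetric = λ (k , u<q , ag) → k , u<q , λ i i<k → sym (ag i i<k)
  ; triangle  = λ {f} {g} {h} → triangle {f} {g} {h}
  }
  where
  larger : ∃ λ q → unit 0 ℚ.< q
  larger = 1ℚ ℚ.+ 1ℚ , ℚ.<-respˡ-≡ (ℚ.+-identityʳ (unit 0)) (ℚ.+-monoʳ-< 1ℚ (unit-positive 0))

  to≡⇒from≡ : ∀ g h → (∀ a → to g a ≡ to h a) → ∀ i → from g i ≡ from h i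
  to≡⇒from≡ g h eq i = trans (cong (from g) (sym (strictlyInverseˡ h i)))
    (trans (cong (from g) (sym (eq (from h i)))) (strictlyInverseʳ g (from h i)))

  from≡⇒to≡ : ∀ g h → (∀ i → from g i ≡ from h i) → ∀ a → to g a ≡ to h a
  from≡⇒to≡ g h = to≡⇒from≡ (↔-sym g) (↔-sym h)

  close⇒from≡ : ∀ {g h} → (∀ q → 0ℚ ℚ.< q → dist g h q) → ∀ i → from g i ≡ from h i
  close⇒from≡ close i =
    let k , u<u , ag = close (unit i) (unit-positive i) in ag i (unit-reflects-< u<u)

  triangle : ∀ {f g h p q} → dist f g p → dist g h q → dist f h (p ℚ.+ q)
  triangle {p = p} {q} (j , u<p , ag) (k , u<q , ag′) with ≤-total j k
  ... | inj₁ j≤k = j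
                 , ℚ.<-trans u<p (subst (ℚ._< p ℚ.+ q) (ℚ.+-identityʳ p)
                     (ℚ.+-monoʳ-< p (ℚ.<-trans (unit-positive k) u<q)))
                 , λ i i<j → trans (ag i i<j) (ag′ i (<-≤-trans i<j j≤k))
  ... | inj₂ k≤j = k
                 , ℚ.<-trans u<q (subst (ℚ._< p ℚ.+ q) (ℚ.+-identityˡ q)
                     (ℚ.+-monoˡ-< q (ℚ.<-trans (unit-positive j) u<p)))
                 , λ i i<k → trans (ag i (<-≤-trans i<k k≤j)) (ag′ i i<k)

-- A subbasic condition `to g a ≡ b` says `from g b ≡ a`, so it is decided by the inverse of `g` on
-- the numbers up to `b`. Conversely, agreement of inverses below `k` amounts to finitely many such
-- conditions.
dist-compatible : Compatible dist
dist-compatible V = mk⇔ open⇒ball ball⇒open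
  where
  open Space S∞-space
  open Neighbourhoods S∞-space

  level : List (ℕ × ℕ) → ℕ
  level []             = 0
  level ((a , b) ∷ is) = suc b ⊔ level is

  agree-basic : ∀ {g h} is → g ∈ basic is → AgreeBelow (level is) g h → h ∈ basic is
  agree-basic []             []ˡ           ag = []ˡ
  agree-basic {g} {h} ((a , b) ∷ is) (refl ∷ˡ ps) ag =
    trans (cong (to h) (trans (sym (strictlyInverseʳ g a)) (ag b (m≤m⊔n (suc b) (level is)))))
          (strictlyInverseˡ h b)
    ∷ˡ agree-basic {g} {h} is ps (λ i i<l → ag i (<-≤-trans i<l (m≤n⊔m (suc b) (level is))))

  open⇒ball : IsOpen V → ∀ {g} → g ∈ V → ∃ λ ε → 0ℚ ℚ.< ε × (∀ {h} → dist g h ε → h ∈ V)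
  open⇒ball V-open {g} g∈V =
    let is , g∈is , is⊆V = V-open {g} g∈V in
    unit (level is) , unit-positive (level is) , λ {h} (k , u<u , ag) →
    is⊆V {h} (agree-basic {g} {h} is g∈is (λ i i<l → ag i (<-trans i<l (unit-reflects-< u<u))))

  ball⇒open : (∀ {g} → g ∈ V → ∃ λ ε → 0ℚ ℚ.< ε × (∀ {h} → dist g h ε → h ∈ V)) → IsOpen V
  ball⇒open ball {g} g∈V =
    let ε , 0<ε , sub = ball {g} g∈V
        k , u<ε       = unit-archimedean 0<ε
    in nbhd-⊆ {g} {λ h → ∀ i → i < k → to h (from g i) ≡ i} {V} (λ {h} p → sub {h} (k , u<ε , λ i i<k →
           trans (sym (strictlyInverseʳ h (from g i))) (cong (from h) (p i i<k))))
         (nbhd-⋂< {g} k (λ i _ → subbasic-nbhd {g} (from g i , i) (strictlyInverseˡ g i)))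

-- Composing with `f` on the right replaces each `from g i` by its image under the injection
-- `from f`.
dist-rightInvariant : RightInvariant dist
dist-rightInvariant f g h q = mk⇔
  (λ (k , u<q , ag) → k , u<q , λ i i<k → cong (from f) (ag i i<k))
  (λ (k , u<q , ag) → k , u<q , λ i i<k → from-injective f (ag i i<k))

agree⇒rightCauchy : (g : ℕ → S∞) → (∀ k n → n ≥ k → AgreeBelow k (g k) (g n)) → RightCauchy g
agree⇒rightCauchy g ag = dist , dist-isMetric , dist-compatible , dist-rightInvariant ,
  λ ε 0<ε → let k , u<ε = unit-archimedean 0<ε in
  k , λ m n m≥k n≥k → k , u<ε , λ i i<k → trans (sym (ag k m m≥k i i<k)) (ag k n n≥k i i<k)

½-sum : ∀ q → ½ ℚ.* q ℚ.+ ½ ℚ.* q ≡ q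
½-sum q = trans (sym (ℚ.*-distribʳ-+ q ½ ½)) (ℚ.*-identityˡ q)

½-positive : ∀ {q} → 0ℚ ℚ.< q → 0ℚ ℚ.< ½ ℚ.* q
½-positive 0<q = ℚ.<-respˡ-≡ (ℚ.*-zeroʳ ½) (ℚ.*-monoʳ-<-pos ½ 0<q)

-- The permutations fixing `a` are an open neighbourhood of the identity, so they include a ball
-- around it. Right translation by the inverse of `g m` shows that, for late `m` and `n`, the
-- product of `g n` with that inverse lies in this ball.
rightCauchy⇒stable : ∀ {g} → RightCauchy g →
  ∀ a → ∃ λ N → ∀ m n → m ≥ N → n ≥ N → from (g m) a ≡ from (g n) a
rightCauchy⇒stable {g} (d , isMetric , compatible , invariant , cauchy) a =
  let ε , 0<ε , sub = Equivalence.to (compatible V)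
        (λ {g} → Neighbourhoods.subbasic-open S∞-space (a , a) {g}) {↔-id ℕ} refl
      N , close     = cauchy (½ ℚ.* ε) (½-positive 0<ε)
  in N , λ m n m≥N n≥N →
    let f = ↔-sym (g m)
        fixed : to (g n) (from (g m) a) ≡ a
        fixed = sub {g n ↔-∘ f} (subst (d (↔-id ℕ) (g n ↔-∘ f)) (½-sum ε)
          -- `g m` composed with its inverse is only pointwise equal to the identity, hence at
          -- distance 0 from it; half of `ε` is spent on this.
          (triangle
            (Equivalence.from (identity (↔-id ℕ) (g m ↔-∘ f)) (λ b → sym (strictlyInverseˡ (g m) b))
              (½ ℚ.* ε) (½-positive 0<ε))
            (Equivalence.to (invariant f (g m) (g n) (½ ℚ.* ε)) (close m n m≥N n≥N))))
    in trans (sym (strictlyInverseʳ (g n) (from (g m) a))) (cong (from (g n)) fixed)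
  where
  open IsMetric isMetric
  V : Pred S∞ 0ℓ
  V h = to h a ≡ a

transpose : ℕ → ℕ → ℕ → ℕ
transpose a b i with i ≟ a | i ≟ b
... | yes _ | _     = b
... | no _  | yes _ = a
... | no _  | no _  = i

transpose-first : ∀ a b → transpose a b a ≡ b
transpose-first a b with a ≟ a
... | yes _  = refl
... | no a≢a = contradiction refl a≢a

transpose-fixes : ∀ {a b i} → i ≢ a → i ≢ b → transpose a b i ≡ i
transpose-fixes {a} {b} {i} i≢a i≢b with i ≟ a | i ≟ b
... | yes i≡a | _       = contradiction i≡a i≢a
... | no _    | yes i≡b = contradiction i≡b i≢b
... | no _    | no _    = refl

transpose-second : ∀ a b → transpose a b b ≡ a
transpose-second a b with b ≟ a | b ≟ b
... | yes b≡a | _      = b≡a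
... | no _    | yes _  = refl
... | no _    | no b≢b = contradiction refl b≢b

transpose-involutive : ∀ a b i → transpose a b (transpose a b i) ≡ i
transpose-involutive a b i = case-split (i ≟ a) (i ≟ b)
  where
  case-split : Dec (i ≡ a) → Dec (i ≡ b) → transpose a b (transpose a b i) ≡ i
  case-split (yes refl) _          =
    trans (cong (transpose a b) (transpose-first a b)) (transpose-second a b)
  case-split (no _)     (yes refl) =
    trans (cong (transpose a b) (transpose-second a b)) (transpose-first a b)
  case-split (no i≢a)   (no i≢b)   =
    trans (cong (transpose a b) (transpose-fixes i≢a i≢b)) (transpose-fixes i≢a i≢b)

transposition : ℕ → ℕ → S∞
transposition a b = mk↔ₛ′ (transpose a b) (transpose a b)
  (transpose-involutive a b) (transpose-involutive a b)

to-injective : (g : S∞) → Injective _≡_ _≡_ (to g)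
to-injective g = from-injective (↔-sym g)

-- By induction: a transposition corrects the value at `k`. It moves no value at `i < k`, since both
-- `to g` and `φ` are injective.
approximation : ∀ {φ : ℕ → ℕ} → Injective _≡_ _≡_ φ →
                ∀ k → ∃ λ g → ∀ i → i < k → to g i ≡ φ i
approximation φ-inj zero = ↔-id ℕ , λ _ ()
approximation {φ} φ-inj (suc k) = transposition (to g k) (φ k) ↔-∘ g , agree
  where
  g : S∞
  g = proj₁ (approximation φ-inj k)
  agree : ∀ i → i < suc k → transpose (to g k) (φ k) (to g i) ≡ φ i
  agree i i<1+k with m<1+n⇒m<n∨m≡n i<1+k
  ... | inj₂ refl = transpose-first (to g k) (φ k)
  ... | inj₁ i<k  = trans
    (transpose-fixes (λ eq → <⇒≢ i<k (to-injective g eq))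
                     (λ eq → <⇒≢ i<k (φ-inj (trans (sym gi≡φi) eq))))
    gi≡φi
    where
    gi≡φi : to g i ≡ φ i
    gi≡φi = proj₂ (approximation φ-inj k) i i<k

record _↪_ {L : Language} (M N : Structure L ℕ) : Set where
  field
    embed     : ℕ → ℕ
    injective : Injective _≡_ _≡_ embed
    fun-hom   : ∀ f as → embed (fun M f as) ≡ fun N f (Vec.map embed as)
    rel-hom   : ∀ R as → rel M R as ≡ rel N R (Vec.map embed as)

map-cong-All : ∀ {A B : Set} {P : A → Set} {f g : A → B} → (∀ {a} → P a → f a ≡ g a) →
               ∀ {n} {as : Vec A n} → All P as → Vec.map f as ≡ Vec.map g as
map-cong-All eq []       = refl
map-cong-All eq (p ∷ ps) = cong₂ _∷_ (eq p) (map-cong-All eq ps)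

bound : ∀ {n} → Vec ℕ n → ℕ
bound []       = 0
bound (a ∷ as) = suc a ⊔ bound as

<bound : ∀ {n} (as : Vec ℕ n) → All (_< bound as) as
<bound []       = []
<bound (a ∷ as) = m≤m⊔n (suc a) (bound as) ∷
                  All.map (λ b< → <-≤-trans b< (m≤n⊔m (suc a) (bound as))) (<bound as)

bound-≤ : ∀ {n k} {as : Vec ℕ n} → All (_< k) as → bound as ≤ k
bound-≤ []           = z≤n
bound-≤ (a<k ∷ as<k) = ⊔-lub a<k (bound-≤ as<k)

module _ {L : Language} (K : Class L) (inv : IsomorphismInvariant K) where
  open RawS∞Space (Mod K inv)
  open Neighbourhoods space

  -- The inverse of `g k` is chosen to agree with the embedding below `k`; convergence of inverses
  -- is what the right-invariant `dist` measures.
  ↪⇒rightEmbeds : ∀ {x x′ : Point} → proj₁ x ↪ proj₁ x′ → RightEmbeds x x′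
  ↪⇒rightEmbeds {x} {x′} E = g , agree⇒rightCauchy g cauchy , converges
    where
    open _↪_ E
    g : ℕ → S∞
    g k = ↔-sym (proj₁ (approximation injective k))

    from-g : ∀ {k n i} → n ≥ k → i < k → from (g n) i ≡ embed i
    from-g {n = n} n≥k i<k = proj₂ (approximation injective n) _ (<-≤-trans i<k n≥k)

    cauchy : ∀ k n → n ≥ k → AgreeBelow k (g k) (g n)
    cauchy k n n≥k i i<k = trans (from-g ≤-refl i<k) (sym (from-g n≥k i<k))

    map-from-g : ∀ {k n m} {as : Vec ℕ m} → n ≥ k → All (_< k) as →
                 Vec.map (from (g n)) as ≡ Vec.map embed as
    map-from-g n≥k as<k = map-cong-All (from-g n≥k) as<k

    rel-agrees : ∀ R as → ∃ λ k → ∀ n → n ≥ k → rel (proj₁ x) R as ≡ rel (g n ·ˢ proj₁ x′) R as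
    rel-agrees R as = let k = bound as ; as<k = <bound as in
      k , λ n n≥k → trans (rel-hom R as) (cong (rel (proj₁ x′) R) (sym (map-from-g n≥k as<k)))

    eventually : ∀ i → x ∈ subbasic i → ∃ λ N → ∀ n → n ≥ N → g n · x′ ∈ subbasic i
    eventually (holds R as) h =
      let k , eq = rel-agrees R as in k , λ n n≥k → subst T (eq n n≥k) h
    eventually (fails R as) h =
      let k , eq = rel-agrees R as in k , λ n n≥k → h ∘ subst T (sym (eq n n≥k))
    eventually (value f as b) refl =
      let k = bound as ; as<k = <bound as in
      -- The value `b` has to lie below the stage too, so that `from (g n)` already maps it as the
      -- embedding does.
      suc b ⊔ k , λ n n≥ →
      trans (cong (to (g n))
        (trans (cong (fun (proj₁ x′) f) (map-from-g (m⊔n≤o⇒n≤o (suc b) k n≥) as<k))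
        (trans (sym (fun-hom f as)) (sym (from-g (m⊔n≤o⇒m≤o (suc b) k n≥) (n<1+n b))))))
      (strictlyInverseˡ (g n) b)

    converges : (λ n → g n · x′) ⟶ x
    converges V V-open x∈V =
      let is , x∈is , is⊆V = V-open {x} x∈V
          N , tail         = eventually-basic {λ n → g n · x′} is
                               (ListAll.map (λ {i} → eventually i) x∈is)
      in N , λ n n≥N → is⊆V {g n · x′} (tail n n≥N)

  -- The inverses have a pointwise limit `φ`. Each single value or relation in `x` holds in
  -- `g n · x′` from some stage on, and pulling it back by `g n` gives the fact about `φ`.
  rightEmbeds⇒↪ : ∀ {x x′ : Point} → RightEmbeds x x′ → proj₁ x ↪ proj₁ x′
  rightEmbeds⇒↪ {x} {x′} (g , rightCauchy , converges) = record
    { embed     = φ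
    ; injective = λ {a} {b} φa≡φb →
        let n = stage a ⊔ stage b in
        from-injective (g n) (trans (from-g (m≤m⊔n (stage a) (stage b)))
          (trans φa≡φb (sym (from-g (m≤n⊔m (stage a) (stage b))))))
    ; fun-hom   = fun-hom
    ; rel-hom   = rel-hom
    }
    where
    stage : ℕ → ℕ
    stage a = proj₁ (rightCauchy⇒stable rightCauchy a)
    φ : ℕ → ℕ
    φ a = from (g (stage a)) a

    from-g : ∀ {a n} → n ≥ stage a → from (g n) a ≡ φ a
    from-g {a} {n} n≥ = proj₂ (rightCauchy⇒stable rightCauchy a) n (stage a) n≥ ≤-refl

    map-from-g : ∀ {m} (as : Vec ℕ m) →
                 ∃ λ N → ∀ n → n ≥ N → Vec.map (from (g n)) as ≡ Vec.map φ as
    map-from-g []       = 0 , λ _ _ → refl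
    map-from-g (a ∷ as) = let N , eq = map-from-g as in
      stage a ⊔ N , λ n n≥ → cong₂ _∷_ (from-g (m⊔n≤o⇒m≤o (stage a) N n≥))
                                        (eq n (m⊔n≤o⇒n≤o (stage a) N n≥))

    fun-hom : ∀ f as → φ (fun (proj₁ x) f as) ≡ fun (proj₁ x′) f (Vec.map φ as)
    fun-hom f as =
      let b      = fun (proj₁ x) f as
          N , eq = map-from-g as
          M , v  = converges (subbasic (value f as b))
                     (λ {y} → subbasic-open (value f as b) {y}) refl
          n      = stage b ⊔ (N ⊔ M)
          n≥N⊔M  = m≤n⊔m (stage b) (N ⊔ M)
      in trans (sym (from-g {n = n} (m≤m⊔n (stage b) (N ⊔ M))))
         (trans (cong (from (g n)) (sym (v n (m⊔n≤o⇒n≤o N M n≥N⊔M))))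
         (trans (strictlyInverseʳ (g n) _)
                (cong (fun (proj₁ x′) f) (eq n (m⊔n≤o⇒m≤o N M n≥N⊔M)))))

    rel-hom : ∀ R as → rel (proj₁ x) R as ≡ rel (proj₁ x′) R (Vec.map φ as)
    rel-hom R as with rel (proj₁ x) R as in eqR
    ... | true =
      let N , eq = map-from-g as
          M , v  = converges (subbasic (holds R as))
                     (λ {y} → subbasic-open (holds R as) {y}) (subst T (sym eqR) _)
      in sym (trans (cong (rel (proj₁ x′) R) (sym (eq (N ⊔ M) (m≤m⊔n N M))))
             (Equivalence.to T-≡ (v (N ⊔ M) (m≤n⊔m N M))))
    ... | false =
      let N , eq = map-from-g as
          M , v  = converges (subbasic (fails R as))
                     (λ {y} → subbasic-open (fails R as) {y}) (subst T eqR)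
      in sym (trans (cong (rel (proj₁ x′) R) (sym (eq (N ⊔ M) (m≤m⊔n N M))))
             (¬T⇒false (v (N ⊔ M) (m≤n⊔m N M))))
      where
      ¬T⇒false : ∀ {b} → ¬ T b → b ≡ false
      ¬T⇒false {true}  ¬t = contradiction _ ¬t
      ¬T⇒false {false} _  = refl

-- Generated substructures and dependence

module _ {L : Language} {A B : Set} (M : Structure L A) (N : Structure L B) (R : A → B → Set)
  (hom : ∀ f {as : Vec A (funArity L f)} {bs : Vec B (funArity L f)} →
         Pointwise R as bs → R (fun M f as) (fun N f bs))
  {S : Pred A 0ℓ} {S′ : Pred B 0ℓ} (base : ∀ {a} → a ∈ S → ∃ λ b → R a b × b ∈ S′) where

  -- Phrased for a relation because it is applied to graphs of maps that are homomorphisms only on a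
  -- closed subset, and to the converses of such graphs.
  Generated-transfer : ∀ {a} → Generated M S a → ∃ λ b → R a b × Generated N S′ b
  All-transfer : ∀ {n} {as : Vec A n} → All (Generated M S) as →
                 ∃ λ (bs : Vec B n) → Pointwise R as bs × All (Generated N S′) bs

  Generated-transfer (gen a∈S) = let b , r , b∈S′ = base a∈S in b , r , gen b∈S′
  Generated-transfer (app f ps) =
    let bs , rs , qs = All-transfer ps in fun N f bs , hom f rs , app f qs

  All-transfer []       = [] , [] , []
  All-transfer (p ∷ ps) =
    let b , r , q = Generated-transfer p ; bs , rs , qs = All-transfer ps in
    b ∷ bs , r ∷ rs , q ∷ qs

module _ {L : Language} {A : Set} {M : Structure L A} {S S′ : Pred A 0ℓ} (S⊆S′ : S ⊆ S′) where

  Generated-⊆     : Generated M S ⊆ Generated M S′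
  All-Generated-⊆ : ∀ {n} → All (Generated M S) {n} ⊆ All (Generated M S′)

  Generated-⊆ (gen a∈S)  = gen (S⊆S′ a∈S)
  Generated-⊆ (app f ps) = app f (All-Generated-⊆ ps)

  All-Generated-⊆ []       = []
  All-Generated-⊆ (p ∷ ps) = Generated-⊆ p ∷ All-Generated-⊆ ps

graph⇒map : ∀ {A B : Set} {P : A → Set} {f : A → B} {n} {as : Vec A n} {bs : Vec B n} →
            Pointwise (λ a b → P a × f a ≡ b) as bs → All P as × Vec.map f as ≡ bs
graph⇒map []             = [] , refl
graph⇒map ((p , e) ∷ rs) = let ps , es = graph⇒map rs in p ∷ ps , cong₂ _∷_ e es

cograph⇒map : ∀ {A B : Set} {P : A → Set} {f : A → B} {n} {as : Vec A n} {bs : Vec B n} →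
              Pointwise (λ b a → P a × f a ≡ b) bs as → All P as × Vec.map f as ≡ bs
cograph⇒map []             = [] , refl
cograph⇒map ((p , e) ∷ rs) = let ps , es = cograph⇒map rs in p ∷ ps , cong₂ _∷_ e es

list-bound : (bs : List ℕ) → ∃ λ k → ∀ {b} → b ∈ˡ bs → b < k
list-bound []       = 0 , λ ()
list-bound (b ∷ bs) = let k , bs<k = list-bound bs in suc b ⊔ k , λ where
  (here refl) → m≤m⊔n (suc b) k
  (there c∈)  → <-≤-trans (bs<k c∈) (m≤n⊔m (suc b) k)

-- Otherwise the arguments 0, ..., k would have k + 1 distinct values below `k`.
injective⇒unbounded : ∀ {φ : ℕ → ℕ} → Injective _≡_ _≡_ φ → ∀ k → ∃ λ a → φ a ≥ k
injective⇒unbounded {φ} φ-inj k = from-search (search (suc k))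
  where
  search : ∀ n → (∃ λ a → φ a ≥ k) ⊎ (∀ a → a < n → φ a < k)
  search zero    = inj₂ λ _ ()
  search (suc n) with search n | φ n <? k
  ... | inj₁ found | _       = inj₁ found
  ... | inj₂ _     | no φn≮k = inj₁ (n , ≮⇒≥ φn≮k)
  ... | inj₂ below | yes φn<k = inj₂ λ a a<1+n → case-split a (m<1+n⇒m<n∨m≡n a<1+n)
    where
    case-split : ∀ a → a < n ⊎ a ≡ n → φ a < k
    case-split a (inj₁ a<n)  = below a a<n
    case-split a (inj₂ refl) = φn<k
  from-search : (∃ λ a → φ a ≥ k) ⊎ (∀ a → a < suc k → φ a < k) → ∃ λ a → φ a ≥ k
  from-search (inj₁ found) = found
  from-search (inj₂ below) =
    let i , j , i<j , eq = Fin.pigeonhole (n<1+n k)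
          (λ (i : Fin (suc k)) → fromℕ< (below (toℕ i) (Fin.toℕ<n i)))
    in contradiction (cong toℕ (Fin.toℕ-injective {i = i} {j} (φ-inj
         (trans (sym (Fin.toℕ-fromℕ< _)) (trans (cong toℕ eq) (Fin.toℕ-fromℕ< _))))))
       (<⇒≢ i<j)

diagonal⇒≡ : ∀ {A : Set} {P : A → Set} {n} {as bs : Vec A n} →
             Pointwise (λ a b → P a × a ≡ b) as bs → All P as × as ≡ bs
diagonal⇒≡ []                = [] , refl
diagonal⇒≡ ((p , refl) ∷ rs) = let ps , es = diagonal⇒≡ rs in p ∷ ps , cong (_ ∷_) es

module _ {L : Language} {A : Set} {M : Structure L A} {S P : Pred A 0ℓ}
  (closed : ∀ f {as} → All P as → P (fun M f as)) (S⊆P : S ⊆ P) where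

  Generated-least     : Generated M S ⊆ P
  All-Generated-least : ∀ {n} → All (Generated M S) {n} ⊆ All P

  Generated-least (gen a∈S)  = S⊆P a∈S
  Generated-least (app f ps) = closed f (All-Generated-least ps)

  All-Generated-least []       = []
  All-Generated-least (p ∷ ps) = Generated-least p ∷ All-Generated-least ps

-- Condition (B3) for the family b.
Dependent : ∀ {L k} → Structure L ℕ → (Fin k → ℕ) → Set
Dependent M b = ∃ λ i → Generated M (λ a → ∃ λ j → j ≢ i × b j ≡ a) (b i)

module _ {L : Language} (M N : Structure L ℕ) (R : ℕ → ℕ → Set)
  (hom : ∀ f {as bs : Vec ℕ (funArity L f)} →
         Pointwise R as bs → R (fun M f as) (fun N f bs))
  (functional : ∀ {a b b′} → R a b → R a b′ → b ≡ b′) where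

  Dependent-transfer : ∀ {k} {b b′ : Fin k → ℕ} → (∀ j → R (b j) (b′ j)) →
                       Dependent M b → Dependent N b′
  Dependent-transfer {b′ = b′} rel (i , p) =
    let a , r , q = Generated-transfer M N R hom
          {S′ = λ a → ∃ λ j → j ≢ i × b′ j ≡ a}
          (λ { (j , j≢i , refl) → b′ j , rel j , j , j≢i , refl }) p
    in i , subst (Generated N _) (functional r (rel i)) q

others : ∀ {k} (b : Fin (suc k) → ℕ) → Fin (suc k) → Vec ℕ k
others b i = Vec.tabulate (b ∘ punchIn i)

others⁻ : ∀ {k} {b : Fin (suc k) → ℕ} {i j} {P : Pred ℕ 0ℓ} → All P (others b i) → j ≢ i → P (b j)
others⁻ {b = b} {i} {P = P} ps j≢i =
  subst (P ∘ b) (Fin.punchIn-punchOut (j≢i ∘ sym)) (tabulate⁻ ps (punchOut (j≢i ∘ sym)))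

-- Dropping one of k + 1 members leaves a tuple of exactly the arity `k`, so a single function
-- symbol can witness dependence.
dependent-by : ∀ {k} (M : Structure (ℒ k) ℕ) {b : Fin (suc k) → ℕ} i f →
               fun M f (others b i) ≡ b i → Dependent M b
dependent-by M {b} i f eq = i , subst (Generated M _) eq
  (app f (tabulate⁺ λ j → gen (punchIn i j , Fin.punchInᵢ≢i i j , refl)))

-- Classical logic and images of embeddings

module Classical (em : ExcludedMiddle (lsuc 0ℓ)) where

  dec : (P : Set) → Dec P
  dec P = map′ lower lift (em {Lift (lsuc 0ℓ) P})

  by-contradiction : {P : Set} → ¬ ¬ P → P
  by-contradiction {P} = decidable-stable (dec P)

  ¬∀⇒∃¬ : {A : Set} {P : A → Set} → ¬ (∀ a → P a) → ∃ λ a → ¬ P a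
  ¬∀⇒∃¬ ¬∀ = by-contradiction λ ¬∃ → ¬∀ λ a → by-contradiction λ ¬p → ¬∃ (a , ¬p)

  factor : ∀ {L} {P Q N : Structure L ℕ} (F : P ↪ N) (G : Q ↪ N) →
           (∀ a → ∃ λ b → _↪_.embed G b ≡ _↪_.embed F a) → P ↪ Q
  factor {P = P} {Q} {N} F G image = record
    { embed     = ψ
    ; injective = λ {a} {b} eq → F.injective
        (trans (sym (Gψ a)) (trans (cong G.embed eq) (Gψ b)))
    ; fun-hom   = λ f as → G.injective (trans (Gψ _) (trans (F.fun-hom f as)
        (trans (cong (fun N f) (sym (map-Gψ as))) (sym (G.fun-hom f _)))))
    ; rel-hom   = λ R as → trans (F.rel-hom R as)
        (trans (cong (rel N R) (sym (map-Gψ as))) (sym (G.rel-hom R _)))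
    }
    where
    module F = _↪_ F
    module G = _↪_ G
    ψ : ℕ → ℕ
    ψ a = proj₁ (image a)
    Gψ : ∀ a → G.embed (ψ a) ≡ F.embed a
    Gψ a = proj₂ (image a)
    map-Gψ : ∀ {m} (as : Vec ℕ m) → Vec.map G.embed (Vec.map ψ as) ≡ Vec.map F.embed as
    map-Gψ []       = refl
    map-Gψ (a ∷ as) = cong₂ _∷_ (Gψ a) (map-Gψ as)

  image-closed : ∀ {L} {Q N : Structure (hat L) ℕ} (F : Q ↪ N) {S : Pred ℕ 0ℓ} →
    (∀ {a} → a ∈ S → ∃ λ b → _↪_.embed F b ≡ a) →
    ∀ {a} → Generated (reduct N) S a → ∃ λ b → _↪_.embed F b ≡ a
  image-closed {Q = Q} {N} F {S} S⊆ p =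
    let b , r , _ = Generated-transfer (reduct N) (reduct Q) (λ a b → b ∈ U × embed b ≡ a)
          (λ f rs → _ , trans (fun-hom f _) (cong (fun N f) (proj₂ (cograph⇒map rs))))
          {S} {U} (λ a∈S → let b , eq = S⊆ a∈S in b , (_ , eq) , _) p
    in b , proj₂ r
    where open _↪_ F

-- The Becker digraph of labeled structures and the upper bound

module Main (em : ExcludedMiddle (lsuc 0ℓ)) (d : ℕ) where
  open Classical em
  open RawS∞Space (Mod-𝓑̂ (suc d)) public
  open Neighbourhoods space public

  abstract
    to-↪ : ∀ {x y : Point} → RightEmbeds x y → proj₁ x ↪ proj₁ y
    to-↪ {x} {y} = rightEmbeds⇒↪ (Labeled (𝓑 (suc d)))
        (Labeled-invariant (𝓑 (suc d)) (𝓑-invariant (suc d))) {x} {y}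

    from-↪ : ∀ {x y : Point} → proj₁ x ↪ proj₁ y → RightEmbeds x y
    from-↪ {x} {y} = ↪⇒rightEmbeds (Labeled (𝓑 (suc d)))
        (Labeled-invariant (𝓑 (suc d)) (𝓑-invariant (suc d))) {x} {y}

  -- Embeddings preserve labels, and an element of `y` is determined by its labels.
  ↪-unique : ∀ {M : Structure (hat (ℒ (suc d))) ℕ} {y : Point} (F G : M ↪ proj₁ y) →
             ∀ a → _↪_.embed F a ≡ _↪_.embed G a
  ↪-unique {y = _ , _ , distinct} F G a = distinct _ _ λ i →
    trans (sym (_↪_.rel-hom F (inj₂ i) (a ∷ []))) (_↪_.rel-hom G (inj₂ i) (a ∷ []))

  ↪-trans : ∀ {L} {P Q N : Structure L ℕ} → P ↪ Q → Q ↪ N → P ↪ N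
  ↪-trans {P = P} {Q} {N} F G = record
    { embed     = G.embed ∘ F.embed
    ; injective = F.injective ∘ G.injective
    ; fun-hom   = λ f as → trans (cong G.embed (F.fun-hom f as)) (trans (G.fun-hom f _)
        (cong (fun N f) (sym (map-∘ G.embed F.embed as))))
    ; rel-hom   = λ R as → trans (F.rel-hom R as) (trans (G.rel-hom R _)
        (cong (rel N R) (sym (map-∘ G.embed F.embed as))))
    }
    where
    module F = _↪_ F
    module G = _↪_ G

  -- With b i in the part of ⁅ i ⁆ but not in that of ∁ ⁅ i ⁆, the b i are independent;
  -- an element of the infinite part of ⊥ outside their finite span is one more.
  cube-bound : ∀ {C : Pred Point 0ℓ} k → cube k EmbedsIn becker C → k ≤ d
  cube-bound {C} k (F , mono) with k ≤? d
  ... | yes k≤d = k≤d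
  ... | no k≰d  = contradiction dependent-family independent
    where
    open IsOrderMonomorphism mono using () renaming (mono to mono-⊆; cancel to cancel-⊆)
    d<k : suc d ≤ k
    d<k = ≰⇒> k≰d

    part : Subset k → Point
    part σ = proj₁ (F σ)
    N : Structure (hat (ℒ (suc d))) ℕ
    N = proj₁ (part ⊤)
    open IsBKL (proj₁ (proj₂ (part ⊤)))

    into : ∀ σ → proj₁ (part σ) ↪ N
    into σ = to-↪ {part σ} {part ⊤} (mono-⊆ (⊆-max σ))
    module I σ = _↪_ (into σ)

    -- The triangle over `part ⊤` commutes because embeddings into it are unique.
    factors : ∀ {σ τ} → σ ⊆ˢ τ → ∀ a → ∃ λ b → I.embed τ b ≡ I.embed σ a
    factors {σ} {τ} σ⊆τ a = let E = to-↪ {part σ} {part τ} (mono-⊆ σ⊆τ) in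
      _↪_.embed E a , ↪-unique {y = part ⊤} (↪-trans E (into τ)) (into σ) a

    -- If every `a` had such a `b`, then `part ⁅ i ⁆` would embed in `part (∁ ⁅ i ⁆)`, and
    -- reflection of arrows would put `i` into `∁ ⁅ i ⁆`.
    private-element : ∀ i → ∃ λ a → ¬ ∃ λ b → I.embed (∁ ⁅ i ⁆) b ≡ I.embed ⁅ i ⁆ a
    private-element i = ¬∀⇒∃¬ λ image →
      x∈p⇒x∉∁p (x∈⁅x⁆ i) (cancel-⊆ (from-↪ {part ⁅ i ⁆} {part (∁ ⁅ i ⁆)}
        (factor (into ⁅ i ⁆) (into (∁ ⁅ i ⁆)) image)) (x∈⁅x⁆ i))

    -- `inject≤` selects the first d + 1 of the `k` coordinates.
    b : Fin (suc d) → ℕ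
    b i = I.embed ⁅ inject≤ i d<k ⁆ (proj₁ (private-element (inject≤ i d<k)))

    co : Fin (suc d) → Subset k
    co i = ∁ ⁅ inject≤ i d<k ⁆

    b∉co : ∀ i → ¬ ∃ λ a → I.embed (co i) a ≡ b i
    b∉co i = proj₂ (private-element (inject≤ i d<k))

    b∈co : ∀ {i j} → j ≢ i → ∃ λ a → I.embed (co i) a ≡ b j
    b∈co {i} {j} j≢i = factors
      (λ x∈ → x∉p⇒x∈∁p λ x∈′ → j≢i (Fin.inject≤-injective d<k d<k j i
        (trans (sym (x∈⁅y⁆⇒x≡y _ x∈)) (x∈⁅y⁆⇒x≡y _ x∈′))))
      (proj₁ (private-element (inject≤ j d<k)))

    span : ∃ λ bs → Generated (reduct N) (_∈ˡ List.tabulate b) ⊆ (_∈ˡ bs)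
    span = locallyFinite (List.tabulate b)

    extra : ∃ λ a → ¬ Generated (reduct N) (_∈ˡ List.tabulate b) (I.embed ⊥ a)
    extra = let m , bs<m = list-bound (proj₁ span)
                a , φa≥m = injective⇒unbounded (I.injective ⊥) m
            in a , λ p → <⇒≱ (bs<m (proj₂ span p)) φa≥m

    v : Fin (suc (suc d)) → ℕ
    v zero    = I.embed ⊥ (proj₁ extra)
    v (suc i) = b i

    v-injective : Injective _≡_ _≡_ v
    v-injective {zero}  {zero}  _  = refl
    v-injective {zero}  {suc j} eq = contradiction
        (gen (subst (_∈ˡ List.tabulate b) (sym eq) (∈-tabulate⁺ {f = b} j))) (proj₂ extra)
    v-injective {suc i} {zero}  eq = contradiction
        (gen (subst (_∈ˡ List.tabulate b) eq (∈-tabulate⁺ {f = b} i))) (proj₂ extra)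
    v-injective {suc i} {suc j} eq with i Fin.≟ j
    ... | yes i≡j = cong suc i≡j
    ... | no i≢j  = contradiction (let a , e = b∈co (i≢j ∘ sym) in a , trans e (sym eq)) (b∉co i)

    dependent-family : ∃ λ i → Generated (reduct N) (λ a → ∃ λ j → j ≢ i × v j ≡ a) (v i)
    dependent-family = dependent v v-injective

    independent : ¬ ∃ λ i → Generated (reduct N) (λ a → ∃ λ j → j ≢ i × v j ≡ a) (v i)
    independent (zero , p) = proj₂ extra (Generated-⊆ (λ where
      (zero , 0≢0 , _)    → contradiction refl 0≢0
      (suc j , _ , refl) → ∈-tabulate⁺ {f = b} j) p)
    -- All members of `v` other than `b i` lie in the image of `part (co i)`, which is closed under
    -- the functions.
    independent (suc i , p) = b∉co i (image-closed (into (co i)) in-co p)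
      where
      in-co : ∀ {a} → (∃ λ j → j ≢ suc i × v j ≡ a) → ∃ λ c → I.embed (co i) c ≡ a
      in-co (zero , _ , refl)    = factors (⊆-min (co i)) (proj₁ extra)
      in-co (suc j , j≢i , refl) = b∈co (j≢i ∘ cong suc)

  -- Finite approximations

  Tuple : Set
  Tuple = Vec ℕ (suc d)

  -- The relations are junk: they do not matter for Generated.
  str : (ℕ → Tuple → ℕ) → Structure (ℒ (suc d)) ℕ
  str fn = record { fun = fn ; rel = λ _ _ → false }

  module Pt (x : Point) where
    fn : ℕ → Tuple → ℕ
    fn = fun (proj₁ x)
    open IsBKL (proj₁ (proj₂ x)) public
    ix : Tuple → ℕ
    ix as = proj₁ (partition as)
    lab : ℕ → ℕ → Bool
    lab = label (proj₁ x)
    distinct : ∀ a b → (∀ i → lab a i ≡ lab b i) → a ≡ b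
    distinct = proj₂ (proj₂ x)

    ix-holds : ∀ as → T (rel (proj₁ x) (inj₁ (ix as)) as)
    ix-holds as = proj₁ (proj₂ (partition as))
    ix-unique : ∀ {j as} → T (rel (proj₁ x) (inj₁ j) as) → ix as ≡ j
    ix-unique {as = as} h = proj₂ (proj₂ (partition as)) h

    fn-trivial : ∀ {i} as → i > ix as → fn i as ≡ first as
    fn-trivial as = trivial as (ix-holds as)

    dependent-str : {b : Fin (suc (suc d)) → ℕ} → Injective _≡_ _≡_ b → Dependent (str fn) b
    dependent-str b-inj = Dependent-transfer _ _ _≡_ (λ f rs → cong (fn f) (Pointwise-≡⇒≡ rs))
      (λ { refl eq → eq }) (λ _ → refl) (dependent _ b-inj)

  structure : (ℕ → Tuple → ℕ) → (Tuple → ℕ) → (ℕ → ℕ → Bool) → Structure (hat (ℒ (suc d))) ℕ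
  structure fn ix lab = record
    { fun = fn
    ; rel = λ { (inj₁ j) as → j ≡ᵇ ix as ; (inj₂ i) (a ∷ []) → lab a i }
    }

  module _ (fn : ℕ → Tuple → ℕ) (ix : Tuple → ℕ) (lab : ℕ → ℕ → Bool) where
    private M = reduct (structure fn ix lab)

    -- (B1) is built into `structure`, where a tuple satisfies exactly the relation number `ix as`.
    -- Bounding the span of each initial segment gives (B4), as every list is bounded.
    point : (∀ {i} as → i > ix as → fn i as ≡ first as) →
            (∀ b → Injective _≡_ _≡_ b → Dependent {k = suc (suc d)} M b) →
            (∀ k → ∃ λ B → ∀ {a} → Generated M (_< k) a → a < B) →
            (∀ a b → (∀ i → lab a i ≡ lab b i) → a ≡ b) → Point
    point triv dep finite distinct = structure fn ix lab , record
      { partition     = λ as → ix as , ≡⇒≡ᵇ (ix as) (ix as) refl , λ {j} h → sym (≡ᵇ⇒≡ j (ix as) h)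
      ; trivial       = λ {i} {j} as h i>j → triv as (subst (i >_) (≡ᵇ⇒≡ j (ix as) h) i>j)
      ; dependent     = dep
      ; locallyFinite = λ as →
          let k , as<k = list-bound as
              B , <B   = finite k
          in upTo B , λ p → ∈-upTo⁺ (<B (Generated-⊆ as<k p))
      } , distinct

  T-ext : ∀ {b c} → (T b → T c) → (T c → T b) → b ≡ c
  T-ext {false} {false} f g = refl
  T-ext {false} {true}  f g = contradiction _ g
  T-ext {true}  {false} f g = contradiction _ f
  T-ext {true}  {true}  f g = refl

  ix≡⇒rel≡ : ∀ (x y : Point) {as bs} → Pt.ix x as ≡ Pt.ix y bs →
             ∀ j → rel (proj₁ x) (inj₁ j) as ≡ rel (proj₁ y) (inj₁ j) bs
  ix≡⇒rel≡ x y {as} {bs} eq j = T-ext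
    (λ h → subst (λ j → T (rel (proj₁ y) (inj₁ j) bs))
             (trans (sym eq) (Pt.ix-unique x h)) (Pt.ix-holds y bs))
    (λ h → subst (λ j → T (rel (proj₁ x) (inj₁ j) as))
             (trans eq (Pt.ix-unique y h)) (Pt.ix-holds x as))

  record AgreeOn (x y : Point) (H : Pred ℕ 0ℓ) (M : ℕ) : Set where
    field
      fn≡  : ∀ i {as} → All H as → Pt.fn x i as ≡ Pt.fn y i as
      ix≡  : ∀ {as} → All H as → Pt.ix x as ≡ Pt.ix y as
      lab≡ : ∀ {a i} → H a → i < M → Pt.lab x a i ≡ Pt.lab y a i

  SameRel : Point → (R : RelSym (hat (ℒ (suc d)))) →
            Vec ℕ (relArity (hat (ℒ (suc d))) R) → Pred Point 0ℓ
  SameRel y R as x = rel (proj₁ x) R as ≡ rel (proj₁ y) R as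

  nbhd-rel : ∀ y R as → Nbhd y (SameRel y R as)
  nbhd-rel y R as with rel (proj₁ y) R as in eq
  ... | true  = nbhd-⊆ {y} {subbasic (holds R as)} {λ x → rel (proj₁ x) R as ≡ true}
                  (Equivalence.to T-≡) (subbasic-nbhd {y} (holds R as) (subst T (sym eq) _))
  ... | false = nbhd-⊆ {y} {subbasic (fails R as)} {λ x → rel (proj₁ x) R as ≡ false}
                  (λ h → T-ext (λ t → contradiction t h) λ ())
                  (subbasic-nbhd {y} (fails R as) (subst T eq))

  -- `AgreeOn` concerns infinitely many function symbols, but by (B2) those with number above
  -- `ix as` return the first entry, so finitely many conditions suffice.
  agree-nbhd : ∀ y k M → Nbhd y (λ x → AgreeOn x y (_< k) M)
  agree-nbhd y k M = nbhd-⊆ {y} {λ x → SameIx x × SameFn x × SameLab x}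
    (λ {x} → combine {x})
    (nbhd-∩ {y} {SameIx} {λ x → SameFn x × SameLab x}
      (nbhd-⋂Vec {y} k (suc d) λ as _ → nbhd-rel y (inj₁ (Pt.ix y as)) as)
      (nbhd-∩ {y} {SameFn} {SameLab}
        (nbhd-⋂Vec {y} k (suc d) λ as _ → nbhd-⋂< {y} (suc (Pt.ix y as)) λ i _ →
          subbasic-nbhd {y} (value i as (Pt.fn y i as)) refl)
        (nbhd-⋂< {y} k λ a _ → nbhd-⋂< {y} M λ i _ → nbhd-rel y (inj₂ i) (a ∷ []))))
    where
    SameIx SameFn SameLab : Pred Point 0ℓ
    SameIx x  = ∀ as → All (_< k) as → SameRel y (inj₁ (Pt.ix y as)) as x
    SameFn x  = ∀ as → All (_< k) as → ∀ i → i < suc (Pt.ix y as) → Pt.fn x i as ≡ Pt.fn y i as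
    SameLab x = ∀ a → a < k → ∀ i → i < M → SameRel y (inj₂ i) (a ∷ []) x

    combine : ∀ {x} → SameIx x × SameFn x × SameLab x → AgreeOn x y (_< k) M
    combine {x} (p , q , r) = record
      { fn≡  = λ i {as} as<k → fn≡ i as as<k (i ≤? Pt.ix y as)
      ; ix≡  = λ {as} → ix≡ as
      ; lab≡ = λ a<k i<M → r _ a<k _ i<M
      }
      where
      ix≡ : ∀ as → All (_< k) as → Pt.ix x as ≡ Pt.ix y as
      ix≡ as as<k = Pt.ix-unique x (subst T (sym (p as as<k)) (Pt.ix-holds y as))
      fn≡ : ∀ i as → All (_< k) as → Dec (i ≤ Pt.ix y as) → Pt.fn x i as ≡ Pt.fn y i as
      fn≡ i as as<k (yes i≤) = q as as<k i (s≤s i≤)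
      fn≡ i as as<k (no i≰)  =
        trans (Pt.fn-trivial x as (subst (i >_) (sym (ix≡ as as<k)) (≰⇒> i≰)))
              (sym (Pt.fn-trivial y as (≰⇒> i≰)))

  -- `k` bounds the arguments and the label numbers occurring in `is`. Agreement is asked on a set
  -- `H` because later `H` is a generated substructure, which need not be an initial segment.
  basic-determined : ∀ x is → x ∈ basic is →
    ∃ λ k → ∀ {y H M} → k ≤ M → (∀ {a} → a < k → H a) → AgreeOn x y H M → y ∈ basic is
  basic-determined x []       []ˡ         = 0 , λ _ _ _ → []ˡ
  basic-determined x (i ∷ is) (x∈i ∷ˡ ps) =
    let k , det = basic-determined x is ps in
    index-bound i ⊔ k , λ {y} {H} {M} ≤M H⊇ ag →
      index-determined {y} {H} {M} i (m⊔n≤o⇒m≤o _ k ≤M) (λ a< → H⊇ (<-≤-trans a< (m≤m⊔n _ k))) ag x∈i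
      ∷ˡ det {y} {H} {M} (m⊔n≤o⇒n≤o (index-bound i) k ≤M)
           (λ a< → H⊇ (<-≤-trans a< (m≤n⊔m (index-bound i) k))) ag
    where
    index-bound : StructureIndex (hat (ℒ (suc d))) → ℕ
    index-bound (holds (inj₁ j) as) = bound as
    index-bound (holds (inj₂ i) as) = bound as ⊔ suc i
    index-bound (fails (inj₁ j) as) = bound as
    index-bound (fails (inj₂ i) as) = bound as ⊔ suc i
    index-bound (value f as b)      = bound as

    lab-agrees : ∀ {y H M} a i → bound (a ∷ []) ⊔ suc i ≤ M →
                 (∀ {b} → b < bound (a ∷ []) ⊔ suc i → H b) →
                 AgreeOn x y H M → Pt.lab x a i ≡ Pt.lab y a i
    lab-agrees a i ≤M H⊇ ag = AgreeOn.lab≡ ag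
      (H⊇ (≤-trans (m≤m⊔n (suc a) 0) (m≤m⊔n (suc a ⊔ 0) (suc i))))
      (m⊔n≤o⇒n≤o (suc a ⊔ 0) (suc i) ≤M)

    index-determined : ∀ {y H M} i → index-bound i ≤ M → (∀ {a} → a < index-bound i → H a) →
                       AgreeOn x y H M → x ∈ subbasic i → y ∈ subbasic i
    index-determined {y} (holds (inj₁ j) as) ≤M H⊇ ag =
      subst T (ix≡⇒rel≡ x y (AgreeOn.ix≡ ag (All.map H⊇ (<bound as))) j)
    index-determined {y} (fails (inj₁ j) as) ≤M H⊇ ag h =
      h ∘ subst T (sym (ix≡⇒rel≡ x y (AgreeOn.ix≡ ag (All.map H⊇ (<bound as))) j))
    index-determined {y} (holds (inj₂ i) (a ∷ [])) ≤M H⊇ ag =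
      subst T (lab-agrees {y} a i ≤M H⊇ ag)
    index-determined {y} (fails (inj₂ i) (a ∷ [])) ≤M H⊇ ag h =
      h ∘ subst T (sym (lab-agrees {y} a i ≤M H⊇ ag))
    index-determined (value f as b) ≤M H⊇ ag eq =
      trans (sym (AgreeOn.fn≡ ag f (All.map H⊇ (<bound as)))) eq

  -- Otherwise every open set around a point of the basic neighbourhood would meet `N`, which would
  -- place that neighbourhood in the closure of `N`.
  avoid : ∀ {N : Pred Point 0ℓ} {y} {P : Pred Point 0ℓ} → NowhereDense N → Nbhd y P →
          ∃ λ x → P x × ∃ λ is → x ∈ basic is × (∀ {z} → z ∈ basic is → ¬ N z)
  avoid {N} {y} {P} nd (is , y∈is , is⊆P)
    with em {∃ λ x → x ∈ basic is × ∃ λ V → IsOpen V × x ∈ V × ¬ (N ≬ V)}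
  ... | yes (x , x∈is , V , V-open , x∈V , N∩V=∅) =
    let js , x∈js , js⊆V = V-open {x} x∈V in
    x , is⊆P x∈is , js , x∈js , λ {z} z∈js z∈N → N∩V=∅ (z , z∈N , js⊆V z∈js)
  ... | no ¬ex = contradiction y∈is (nd (basic is) (λ {x} → basic-open is {x}) dense y)
    where
    dense : basic is ⊆ Closure N
    dense {x} x∈is V V-open x∈V = by-contradiction λ N∩V=∅ → ¬ex (x , x∈is , V , V-open , x∈V , N∩V=∅)

  -- A finite approximation to a structure with domain dom ⊆ ℕ, in which the elements
  -- with support (t) contained in τ form a substructure for every τ. The latter is
  -- partially enumerated by e τ, which is defined on G τ. The unique relation holding
  -- of as is number ix as, labels with index below m are final, and c and κ bound dom
  -- and G. Values outside dom and G are junk.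
  record State : Set₁ where
    field
      dom : Pred ℕ 0ℓ
      fn  : ℕ → Tuple → ℕ
      ix  : Tuple → ℕ
      t   : ℕ → Subset d
      lab : ℕ → ℕ → Bool
      m   : ℕ
      G   : Subset d → Pred ℕ 0ℓ
      e   : Subset d → ℕ → ℕ
      c   : ℕ
      κ   : Subset d → ℕ
      dom<c    : ∀ {z} → dom z → z < c
      closed   : ∀ i {as} → All dom as → dom (fn i as)
      triv     : ∀ {i as} → All dom as → i > ix as → fn i as ≡ first as
      supp     : ∀ i {as} → All dom as → ∀ {τ} → All (λ a → t a ⊆ˢ τ) as → t (fn i as) ⊆ˢ τ
      depend   : ∀ {b : Fin (suc (suc d)) → ℕ} → Injective _≡_ _≡_ b → (∀ j → dom (b j)) →
                 Dependent (str fn) b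
      G<κ      : ∀ {τ h} → G τ h → h < κ τ
      e-dom    : ∀ {τ h} → G τ h → dom (e τ h)
      e-supp   : ∀ {τ h} → G τ h → t (e τ h) ⊆ˢ τ
      e-inj    : ∀ {τ h h′} → G τ h → G τ h′ → e τ h ≡ e τ h′ → h ≡ h′

    All-e-dom : ∀ {τ n} {hs : Vec ℕ n} → All (G τ) hs → All dom (Vec.map (e τ) hs)
    All-e-dom ps = map⁺ (All.map e-dom ps)

    All-e-supp : ∀ {τ n} {hs : Vec ℕ n} → All (G τ) hs → All (λ a → t a ⊆ˢ τ) (Vec.map (e τ) hs)
    All-e-supp ps = map⁺ (All.map (λ {h} → e-supp {h = h}) ps)

    Covered : Subset d → Set
    Covered τ = ∀ {z} → dom z → t z ⊆ˢ τ → ∃ λ h → G τ h × e τ h ≡ z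

  infix 4 _≼_
  record _≼_ (S S′ : State) : Set where
    private
      module S = State S
      module S′ = State S′
    field
      dom⊆ : ∀ {z} → S.dom z → S′.dom z
      fn≡  : ∀ i {as} → All S.dom as → S.fn i as ≡ S′.fn i as
      ix≡  : ∀ {as} → All S.dom as → S.ix as ≡ S′.ix as
      t≡   : ∀ {z} → S.dom z → S.t z ≡ S′.t z
      lab≡ : ∀ {z i} → S.dom z → i < S.m → S.lab z i ≡ S′.lab z i
      m≤   : S.m ≤ S′.m
      G⊆   : ∀ {τ h} → S.G τ h → S′.G τ h
      e≡   : ∀ {τ h} → S.G τ h → S.e τ h ≡ S′.e τ h

  ≼-refl : ∀ {S} → S ≼ S
  ≼-refl = record
    { dom⊆ = id ; fn≡ = λ _ _ → refl ; ix≡ = λ _ → refl ; t≡ = λ _ → refl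
    ; lab≡ = λ _ _ → refl ; m≤ = ≤-refl ; G⊆ = id ; e≡ = λ _ → refl }

  ≼-trans : ∀ {S S′ S″} → S ≼ S′ → S′ ≼ S″ → S ≼ S″
  ≼-trans p q = record
    { dom⊆ = λ z → q.dom⊆ (p.dom⊆ z)
    ; fn≡  = λ i as → trans (p.fn≡ i as) (q.fn≡ i (All.map p.dom⊆ as))
    ; ix≡  = λ as → trans (p.ix≡ as) (q.ix≡ (All.map p.dom⊆ as))
    ; t≡   = λ z → trans (p.t≡ z) (q.t≡ (p.dom⊆ z))
    ; lab≡ = λ z i<m → trans (p.lab≡ z i<m) (q.lab≡ (p.dom⊆ z) (<-≤-trans i<m p.m≤))
    ; m≤   = ≤-trans p.m≤ q.m≤
    ; G⊆   = λ g → q.G⊆ (p.G⊆ g)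
    ; e≡   = λ g → trans (p.e≡ g) (q.e≡ (p.G⊆ g))
    }
    where
    module p = _≼_ p
    module q = _≼_ q

  -- `e σ` embeds the substructure of `x` with domain `H` into `S`, as far as labels below `M` are
  -- concerned.
  record Realized (S : State) (σ : Subset d) (x : Point) (H : Pred ℕ 0ℓ) (M : ℕ) : Set where
    open State S
    field
      M≤m     : M ≤ m
      H⊆G     : ∀ {h} → H h → G σ h
      x-closed : ∀ i {hs} → All H hs → H (Pt.fn x i hs)
      e-fn    : ∀ i {hs} → All H hs → e σ (Pt.fn x i hs) ≡ fn i (Vec.map (e σ) hs)
      e-ix    : ∀ {hs} → All H hs → Pt.ix x hs ≡ ix (Vec.map (e σ) hs)
      e-lab   : ∀ {h i} → H h → i < M → Pt.lab x h i ≡ lab (e σ h) i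

  realized-≼ : ∀ {S S′ σ x H M} → S ≼ S′ → Realized S σ x H M → Realized S′ σ x H M
  realized-≼ {S} {S′} {σ} {x} {H} p r = record
    { M≤m      = ≤-trans M≤m m≤
    ; H⊆G      = λ h → G⊆ (H⊆G h)
    ; x-closed = x-closed
    ; e-fn     = λ i hs → trans (sym (e≡ (H⊆G (x-closed i hs)))) (trans (e-fn i hs)
        (trans (fn≡ i (State.All-e-dom S (All.map H⊆G hs))) (cong (State.fn S′ i) (map-e≡ hs))))
    ; e-ix     = λ hs → trans (e-ix hs)
        (trans (ix≡ (State.All-e-dom S (All.map H⊆G hs))) (cong (State.ix S′) (map-e≡ hs)))
    ; e-lab    = λ {_} {i} h i<M → trans (e-lab h i<M)
        (trans (lab≡ (State.e-dom S (H⊆G h)) (<-≤-trans i<M M≤m))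
          (cong (λ z → State.lab S′ z i) (e≡ (H⊆G h))))
    }
    where
    open _≼_ p
    open Realized r
    map-e≡ : ∀ {n} {hs : Vec ℕ n} → All H hs → Vec.map (State.e S σ) hs ≡ Vec.map (State.e S′ σ) hs
    map-e≡ hs = map-cong-All (λ h → e≡ (H⊆G h)) hs

  module Cover (S : State) where
    open State S

    Missing : Subset d → ℕ → Set
    Missing τ z = dom z × t z ⊆ˢ τ × ¬ ∃ λ g → G τ g × e τ g ≡ z

    -- An element `z` that `e τ` misses is enumerated at place `κ τ + z`, beyond all places in use.
    G⁺ : Subset d → Pred ℕ 0ℓ
    G⁺ τ h = G τ h ⊎ ∃ λ z → Missing τ z × κ τ + z ≡ h

    e⁺ : Subset d → ℕ → ℕ
    e⁺ τ h with dec (G τ h)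
    ... | yes _ = e τ h
    ... | no _  = h ∸ κ τ

    e⁺-old : ∀ {τ h} → G τ h → e⁺ τ h ≡ e τ h
    e⁺-old {τ} {h} g with dec (G τ h)
    ... | yes _ = refl
    ... | no ¬g = contradiction g ¬g

    e⁺-new : ∀ {τ} z → e⁺ τ (κ τ + z) ≡ z
    e⁺-new {τ} z with dec (G τ (κ τ + z))
    ... | yes g = contradiction (G<κ g) (m+n≮m (κ τ) z)
    ... | no _  = m+n∸m≡n (κ τ) z

    cover : State
    cover = record
      { dom = dom ; fn = fn ; ix = ix ; t = t ; lab = lab ; m = m ; G = G⁺ ; e = e⁺ ; c = c
      ; κ = λ τ → κ τ + c
      ; dom<c = dom<c ; closed = closed ; triv = triv ; supp = supp ; depend = depend
      ; G<κ    = λ { {τ} (inj₁ g) → <-≤-trans (G<κ g) (m≤m+n (κ τ) c)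
                   ; {τ} (inj₂ (z , (z∈ , _) , refl)) → +-monoʳ-< (κ τ) (dom<c z∈) }
      ; e-dom  = λ { (inj₁ g) → subst dom (sym (e⁺-old g)) (e-dom g)
                   ; (inj₂ (z , (z∈ , _) , refl)) → subst dom (sym (e⁺-new z)) z∈ }
      ; e-supp = λ { {τ} (inj₁ g) → subst (λ z → t z ⊆ˢ τ) (sym (e⁺-old g)) (e-supp g)
                   ; {τ} (inj₂ (z , (_ , z⊆τ , _) , refl)) →
                       subst (λ z → t z ⊆ˢ τ) (sym (e⁺-new z)) z⊆τ }
      ; e-inj  = inj
      }
      where
      inj : ∀ {τ h h′} → G⁺ τ h → G⁺ τ h′ → e⁺ τ h ≡ e⁺ τ h′ → h ≡ h′
      inj (inj₁ g) (inj₁ g′) eq = e-inj g g′ (trans (sym (e⁺-old g)) (trans eq (e⁺-old g′)))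
      inj (inj₁ g) (inj₂ (z , (_ , _ , ¬g) , refl)) eq =
        contradiction (_ , g , trans (sym (e⁺-old g)) (trans eq (e⁺-new z))) ¬g
      inj (inj₂ (z , (_ , _ , ¬g) , refl)) (inj₁ g) eq =
        contradiction (_ , g , trans (sym (e⁺-old g)) (trans (sym eq) (e⁺-new z))) ¬g
      inj {τ} (inj₂ (z , _ , refl)) (inj₂ (w , _ , refl)) eq =
        cong (κ τ +_) (trans (sym (e⁺-new z)) (trans eq (e⁺-new w)))

    ≼-cover : S ≼ cover
    ≼-cover = record
      { dom⊆ = id ; fn≡ = λ _ _ → refl ; ix≡ = λ _ → refl ; t≡ = λ _ → refl
      ; lab≡ = λ _ _ → refl ; m≤ = ≤-refl ; G⊆ = inj₁ ; e≡ = λ g → sym (e⁺-old g) }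

    covered : ∀ {τ} → State.Covered cover τ
    covered {τ} {z} z∈ z⊆τ with dec (∃ λ g → G τ g × e τ g ≡ z)
    ... | yes (g , g∈ , eq) = g , inj₁ g∈ , trans (e⁺-old g∈) eq
    ... | no ¬g             = κ τ + z , inj₂ (z , (z∈ , z⊆τ , ¬g) , refl) , e⁺-new z

  -- Extends the finite structure that e σ enumerates to all of ℕ, by letting a tuple
  -- outside G σ generate everything below it.
  module Extend (S : State) (σ : Subset d) (covered : State.Covered S σ) where
    open State S

    preimage : ∀ i {hs} → All (G σ) hs → ∃ λ h → G σ h × e σ h ≡ fn i (Vec.map (e σ) hs)
    preimage i hs = covered (closed i (All-e-dom hs)) (supp i (All-e-dom hs) (All-e-supp hs))

    -- A tuple outside `G σ` generates all numbers below this bound. Including `κ σ` ensures that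
    -- numbers from the bound on are outside `G σ`; still, every initial segment of length at least
    -- `κ σ` is closed.
    top : Tuple → ℕ
    top as = bound as ⊔ κ σ

    yfn : ℕ → Tuple → ℕ
    yfn i as with dec (All (G σ) as)
    ... | yes p = proj₁ (preimage i p)
    ... | no _ with i <? top as
    ...   | yes _ = i
    ...   | no _  = first as

    yix : Tuple → ℕ
    yix as with dec (All (G σ) as)
    ... | yes _ = ix (Vec.map (e σ) as)
    ... | no _  = top as

    -- From `m` on, label `m + a` marks `a` alone, which separates all elements.
    ylab : ℕ → ℕ → Bool
    ylab a i with i <? m
    ... | yes _ = lab (e σ a) i
    ... | no _  = i ≡ᵇ m + a

    yfn-G : ∀ i {as} → All (G σ) as → G σ (yfn i as) × e σ (yfn i as) ≡ fn i (Vec.map (e σ) as)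
    yfn-G i {as} p with dec (All (G σ) as)
    ... | yes p′ = proj₂ (preimage i p′)
    ... | no ¬p  = contradiction p ¬p

    yix-G : ∀ {as} → All (G σ) as → yix as ≡ ix (Vec.map (e σ) as)
    yix-G {as} p with dec (All (G σ) as)
    ... | yes _ = refl
    ... | no ¬p = contradiction p ¬p

    ylab-old : ∀ {a i} → i < m → ylab a i ≡ lab (e σ a) i
    ylab-old {i = i} i<m with i <? m
    ... | yes _   = refl
    ... | no  i≮m = contradiction i<m i≮m

    ylab-new : ∀ a b → ylab a (m + b) ≡ (m + b ≡ᵇ m + a)
    ylab-new a b with m + b <? m
    ... | yes lt = contradiction lt (m+n≮m m b)
    ... | no _   = refl

    yfn-mixed : ∀ i {as} → ¬ All (G σ) as → i < top as → yfn i as ≡ i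
    yfn-mixed i {as} ¬p i< with dec (All (G σ) as)
    ... | yes p = contradiction p ¬p
    ... | no _ with i <? top as
    ...   | yes _ = refl
    ...   | no ≮  = contradiction i< ≮

    yfn-trivial : ∀ {i} as → i > yix as → yfn i as ≡ first as
    yfn-trivial {i} as@(a ∷ _) i> with dec (All (G σ) as)
    ... | yes p@(q ∷ _) = let _ , g , eq = preimage i p in e-inj g q (trans eq (triv (All-e-dom p) i>))
    ... | no _ with i <? top as
    ...   | yes i< = contradiction i< (<-asym i>)
    ...   | no _   = refl

    yfn-below : ∀ i {k} {as : Tuple} → κ σ ≤ k → All (_< k) as → yfn i as < k
    yfn-below i {k} {as} κ≤k as<k with dec (All (G σ) as)
    ... | yes p = <-≤-trans (G<κ (proj₁ (proj₂ (preimage i p)))) κ≤k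
    ... | no _ with i <? top as
    ...   | yes i< = <-≤-trans i< (⊔-lub (bound-≤ as<k) κ≤k)
    ...   | no _ with as | as<k
    ...     | a ∷ _ | a<k ∷ _ = a<k

    y : Structure (ℒ (suc d)) ℕ
    y = reduct (structure yfn yix ylab)

    -- A family inside `G σ` is dependent already in `S`. Otherwise take `b j₀` outside `G σ` and
    -- another member `b i`. If `b i` is not below the `top` of the other members, it is outside
    -- `G σ` and greater than `b j₀`, so the tuple without `b j₀` generates `b j₀`.
    y-dependent : (b : Fin (suc (suc d)) → ℕ) → Injective _≡_ _≡_ b → Dependent y b
    y-dependent b b-inj with dec (∀ j → G σ (b j))
    ... | yes all-G = Dependent-transfer (str fn) y (λ z h → G σ h × e σ h ≡ z)
          (λ f rs → let hs∈ , eq = cograph⇒map rs ; g , eq′ = yfn-G f hs∈ in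
            g , trans eq′ (cong (fn f) eq))
          (λ (g , eq) (g′ , eq′) → e-inj g g′ (trans eq (sym eq′)))
          (λ j → all-G j , refl)
          (depend (λ {i} {j} eq → b-inj (e-inj (all-G i) (all-G j) eq)) (λ j → e-dom (all-G j)))
    ... | no ¬all-G = case-split (b i <? top (others b i))
      where
      j₀ : Fin (suc (suc d))
      j₀ = proj₁ (¬∀⇒∃¬ ¬all-G)
      i : Fin (suc (suc d))
      i = punchIn j₀ zero
      i≢j₀ : i ≢ j₀
      i≢j₀ = Fin.punchInᵢ≢i j₀ zero
      case-split : Dec (b i < top (others b i)) → Dependent y b
      case-split (yes bi<) = dependent-by _ i (b i)
        (yfn-mixed (b i) (λ p → proj₂ (¬∀⇒∃¬ ¬all-G) (others⁻ {b = b} p (i≢j₀ ∘ sym))) bi<)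
      case-split (no bi≮) = dependent-by _ j₀ (b j₀)
        (yfn-mixed (b j₀)
          (λ p → <⇒≱ (G<κ (others⁻ {b = b} p i≢j₀))
                     (m⊔n≤o⇒n≤o (bound (others b i)) (κ σ) (≮⇒≥ bi≮)))
          (<-≤-trans
            (<-trans (<-≤-trans (others⁻ {b = b} (<bound (others b i)) (i≢j₀ ∘ sym))
                                (m⊔n≤o⇒m≤o (bound (others b i)) (κ σ) (≮⇒≥ bi≮)))
                     (others⁻ {b = b} (<bound (others b j₀)) i≢j₀))
            (m≤m⊔n (bound (others b j₀)) (κ σ))))

    extension : Point
    extension = point yfn yix ylab yfn-trivial y-dependent
      (λ k → k ⊔ κ σ , Generated-least {M = y} (λ f → yfn-below f (m≤n⊔m k (κ σ)))
        (λ a<k → <-≤-trans a<k (m≤m⊔n k (κ σ))))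
      (λ a b same → +-cancelˡ-≡ m a b (≡ᵇ⇒≡ (m + a) (m + b)
        (subst T (trans (sym (ylab-new a a)) (trans (same (m + a)) (ylab-new b a)))
          (≡⇒≡ᵇ (m + a) (m + a) refl))))

    -- `avoid` will replace the extension by a nearby point `x`; agreement below `κ σ` preserves the
    -- copy of the σ-part of `S` inside it.
    close-realized : ∀ {x} → AgreeOn x extension (_< κ σ) m → Realized S σ x (G σ) m
    close-realized {x} ag = record
      { M≤m      = ≤-refl
      ; H⊆G      = id
      ; x-closed = λ i hs → subst (G σ) (sym (fn≡ i (All.map G<κ hs))) (proj₁ (yfn-G i hs))
      ; e-fn     = λ i hs → trans (cong (e σ) (fn≡ i (All.map G<κ hs))) (proj₂ (yfn-G i hs))
      ; e-ix     = λ hs → trans (ix≡ (All.map G<κ hs)) (yix-G hs)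
      ; e-lab    = λ {h} h∈ i<m → trans (lab≡ (G<κ h∈) i<m) (ylab-old {h} i<m)
      }
      where open AgreeOn ag

  -- Amalgamation

  All-pull : ∀ {P Q : Pred ℕ 0ℓ} {f : ℕ → ℕ} → (∀ {h} → P (f h) → Q h) →
             ∀ {n} {hs : Vec ℕ n} → All P (Vec.map f hs) → All Q hs
  All-pull pull ps = All.map pull (map⁻ ps)

  missed : ∀ {k} (h : Fin k → Fin (suc k)) → ∃ λ i → ∀ j → h j ≢ i
  missed {k} h with dec (∃ λ i → ∀ j → h j ≢ i)
  ... | yes found = found
  ... | no ¬found =
    let i , j , i<j , eq = Fin.pigeonhole (n<1+n k) section in
    contradiction (cong toℕ (trans (sym (h-section i)) (trans (cong h eq) (h-section j)))) (<⇒≢ i<j)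
    where
    hit : ∀ i → ∃ λ j → h j ≡ i
    hit i = by-contradiction λ ¬∃ → ¬found (i , λ j eq → ¬∃ (j , eq))
    section : Fin (suc k) → Fin k
    section i = proj₁ (hit i)
    h-section : ∀ i → h (section i) ≡ i
    h-section i = proj₂ (hit i)

  -- Keep u, keep v for the coordinate c₀, and keep one member for each of the other
  -- d − 1 coordinates.
  redundant : (s : Fin (suc (suc d)) → Subset d) → ∀ u v {c₀} → c₀ ∈ˢ s v →
              ∃ λ i → i ≢ u × i ≢ v × (∀ {c} → c ∈ˢ s i → ∃ λ j → j ≢ i × c ∈ˢ s j)
  redundant s u v {c₀} c₀∈v =
    let i , miss = missed keep in
    i , (λ i≡u → miss zero (sym i≡u))
      , (λ i≡v → miss (suc c₀) (trans (keep-c₀) (sym i≡v)))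
      , λ {c} c∈i → keep (suc c) , miss (suc c) , keeps (_ , c∈i)
    where
    keep : Fin (suc d) → Fin (suc (suc d))
    keep zero = u
    keep (suc c) with c Fin.≟ c₀ | dec (∃ λ j → c ∈ˢ s j)
    ... | yes _ | _           = v
    ... | no _  | yes (j , _) = j
    -- A default for coordinates that occur in no support.
    ... | no _  | no _        = u
    keep-c₀ : keep (suc c₀) ≡ v
    keep-c₀ with c₀ Fin.≟ c₀
    ... | yes _ = refl
    ... | no ≢  = contradiction refl ≢
    keeps : ∀ {c} → (∃ λ j → c ∈ˢ s j) → c ∈ˢ s (keep (suc c))
    keeps {c} ex with c Fin.≟ c₀ | dec (∃ λ j → c ∈ˢ s j)
    ... | yes refl | _            = c₀∈v
    ... | no _     | yes (j , c∈) = c∈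
    ... | no _     | no ¬ex       = contradiction ex ¬ex

  Hull : Point → ℕ → Pred ℕ 0ℓ
  Hull x K = Generated (reduct (proj₁ x)) (_< K)

  hull-bounded : ∀ x K → ∃ λ B → ∀ {h} → Hull x K h → h < B
  hull-bounded x K =
    let bs , sub = Pt.locallyFinite x (upTo K)
        B , bs<B = list-bound bs
    in B , λ p → bs<B (sub (Generated-⊆ ∈-upTo⁺ p))

  -- The free amalgam over G σ of S and of the substructure H of x generated by the
  -- numbers below K. The new elements get support σ, and a tuple that lies neither in S
  -- nor in H generates everything whose support is contained in the union of the
  -- supports of the tuple.
  module Amalgam (S : State) (σ : Subset d) (covered : State.Covered S σ)
    (x : Point) (realized : Realized S σ x (State.G S σ) (State.m S))
    (K : ℕ) (κ<K : State.κ S σ < K) (M : ℕ) (m≤M : State.m S ≤ M) where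

    open State S
    module R = Realized realized
    module x = Pt x

    H : Pred ℕ 0ℓ
    H = Hull x K

    B : ℕ
    B = proj₁ (hull-bounded x K)
    H<B : ∀ {h} → H h → h < B
    H<B = proj₂ (hull-bounded x K)

    G⇒H : ∀ {h} → G σ h → H h
    G⇒H g = gen (<-trans (G<κ g) κ<K)

    -- Places not yet enumerated go to numbers from `c` on, hence outside `dom`; thus `E τ` is
    -- injective on all of ℕ.
    E : Subset d → ℕ → ℕ
    E τ h with dec (G τ h)
    ... | yes _ = e τ h
    ... | no _  = c + h

    E-old : ∀ {τ h} → G τ h → E τ h ≡ e τ h
    E-old {τ} {h} g with dec (G τ h)
    ... | yes _ = refl
    ... | no ¬g = contradiction g ¬g

    dom-E : ∀ {τ h} → dom (E τ h) → G τ h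
    dom-E {τ} {h} z∈ with dec (G τ h)
    ... | yes g = g
    ... | no _  = contradiction (dom<c z∈) (m+n≮m c h)

    E-injective : ∀ {τ h h′} → E τ h ≡ E τ h′ → h ≡ h′
    E-injective {τ} {h} {h′} eq with dec (G τ h) | dec (G τ h′)
    ... | yes g | yes g′ = e-inj g g′ eq
    ... | yes g | no _   = contradiction (subst (_< c) eq (dom<c (e-dom g))) (m+n≮m c h′)
    ... | no _  | yes g′ = contradiction (subst (_< c) (sym eq) (dom<c (e-dom g′))) (m+n≮m c h)
    ... | no _  | no _   = +-cancelˡ-≡ c h h′ eq

    map-E-old : ∀ {τ n} {hs : Vec ℕ n} → All (G τ) hs → Vec.map (E τ) hs ≡ Vec.map (e τ) hs
    map-E-old = map-cong-All E-old

    map-E-injective : ∀ {n} {hs hs′ : Vec ℕ n} → Vec.map (E σ) hs ≡ Vec.map (E σ) hs′ → hs ≡ hs′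
    map-E-injective {hs = []}     {[]}     _  = refl
    map-E-injective {hs = h ∷ hs} {h′ ∷ _} eq =
      let eq₁ , eq₂ = ∷-injective eq in cong₂ _∷_ (E-injective {σ} eq₁) (map-E-injective eq₂)

    N : Pred ℕ 0ℓ
    N z = ∃ λ h → H h × E σ h ≡ z

    dom⁺ : Pred ℕ 0ℓ
    dom⁺ z = dom z ⊎ N z

    c⁺ : ℕ
    c⁺ = c + B

    dom⁺<c⁺ : ∀ {z} → dom⁺ z → z < c⁺
    dom⁺<c⁺ (inj₁ z∈) = <-≤-trans (dom<c z∈) (m≤m+n c B)
    dom⁺<c⁺ (inj₂ (h , h∈ , refl)) with dec (G σ h)
    ... | yes g = <-≤-trans (dom<c (e-dom g)) (m≤m+n c B)
    ... | no _  = +-monoʳ-< c (H<B h∈)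

    t⁺ : ℕ → Subset d
    t⁺ z with dec (dom z)
    ... | yes _ = t z
    ... | no _  = σ

    t⁺-old : ∀ {z} → dom z → t⁺ z ≡ t z
    t⁺-old {z} z∈ with dec (dom z)
    ... | yes _ = refl
    ... | no z∉ = contradiction z∈ z∉

    t⁺-new : ∀ {z} → ¬ dom z → t⁺ z ≡ σ
    t⁺-new {z} z∉ with dec (dom z)
    ... | yes z∈ = contradiction z∈ z∉
    ... | no _   = refl

    t⁺-E : ∀ {h} → t⁺ (E σ h) ⊆ˢ σ
    t⁺-E {h} with dec (G σ h)
    ... | yes g = subst (_⊆ˢ σ) (sym (t⁺-old (e-dom g))) (e-supp g)
    ... | no ¬g = subst (_⊆ˢ σ) (sym (t⁺-new (λ z∈ → m+n≮m c h (dom<c z∈)))) id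

    -- On `N` the labels come from `x`, even for old elements: their labels from `m` on were not
    -- final, and below `m` the two agree.
    lab⁺ : ℕ → ℕ → Bool
    lab⁺ z i with dec (N z)
    ... | yes (h , _) = x.lab h i
    ... | no _        = lab z i

    lab⁺-N : ∀ {h i} → H h → x.lab h i ≡ lab⁺ (E σ h) i
    lab⁺-N {h} {i} h∈ with dec (N (E σ h))
    ... | yes (h′ , _ , eq) = cong (λ a → x.lab a i) (E-injective {σ} (sym eq))
    ... | no ¬N             = contradiction (h , h∈ , refl) ¬N

    lab⁺-old : ∀ {z i} → dom z → i < m → lab z i ≡ lab⁺ z i
    lab⁺-old {z} {i} z∈ i<m with dec (N z)
    ... | yes (h , _ , refl) = let g = dom-E z∈ in
      trans (cong (λ z → lab z i) (E-old g)) (sym (R.e-lab g i<m))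
    ... | no _ = refl

    InH : ∀ {n} → Pred (Vec ℕ n) 0ℓ
    InH as = ∃ λ hs → All H hs × Vec.map (E σ) hs ≡ as

    data Kind (as : Tuple) : Set where
      old   : All dom as → Kind as
      inH   : ¬ All dom as → InH as → Kind as
      mixed : ¬ All dom as → ¬ InH as → Kind as

    kind : ∀ as → Kind as
    kind as with dec (All dom as) | dec (InH as)
    ... | yes p | _     = old p
    ... | no ¬p | yes q = inH ¬p q
    ... | no ¬p | no ¬q = mixed ¬p ¬q

    -- Containment of a support in the union of the supports of the entries, phrased by the upper
    -- bounds `τ` of that union.
    Below : Tuple → Pred ℕ 0ℓ
    Below as z = ∀ {τ} → All (λ a → t⁺ a ⊆ˢ τ) as → t⁺ z ⊆ˢ τ

    -- On a mixed tuple the number of the symbol serves as the name of the element to be generated.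
    -- The kind is an argument so that properties can be proved by cases on it.
    fnK : ∀ {as} → Kind as → ℕ → ℕ
    fnK {as} (old _)              i = fn i as
    fnK      (inH _ (hs , _))     i = E σ (x.fn i hs)
    fnK {as} (mixed _ _)          i with dec (dom⁺ i × Below as i)
    ... | yes _ = i
    ... | no _  = first as

    ixK : ∀ {as} → Kind as → ℕ
    ixK {as} (old _)          = ix as
    ixK      (inH _ (hs , _)) = x.ix hs
    -- All elements are below `c⁺`, so (B2) imposes nothing on the symbols that name them.
    ixK      (mixed _ _)      = c⁺

    fn⁺ : ℕ → Tuple → ℕ
    fn⁺ i as = fnK (kind as) i

    ix⁺ : Tuple → ℕ
    ix⁺ as = ixK (kind as)

    fnK-old : ∀ i {as} (k : Kind as) → All dom as → fn i as ≡ fnK k i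
    fnK-old i (old _)     p = refl
    fnK-old i (inH ¬p _)   p = contradiction p ¬p
    fnK-old i (mixed ¬p _) p = contradiction p ¬p

    ixK-old : ∀ {as} (k : Kind as) → All dom as → ix as ≡ ixK k
    ixK-old (old _)     p = refl
    ixK-old (inH ¬p _)   p = contradiction p ¬p
    ixK-old (mixed ¬p _) p = contradiction p ¬p

    -- A tuple in both `dom` and the image of `H` is computed in `S`, and there `realized` shows
    -- that `x` yields the same value.
    fnK-H : ∀ i {hs} (k : Kind (Vec.map (E σ) hs)) → All H hs → E σ (x.fn i hs) ≡ fnK k i
    fnK-H i {hs} (old p) _ =
      let gs = All-pull dom-E p in
      trans (E-old (R.x-closed i gs)) (trans (R.e-fn i gs) (cong (fn i) (sym (map-E-old gs))))
    fnK-H i (inH _ (hs′ , _ , eq)) _ = cong (E σ ∘ x.fn i) (sym (map-E-injective eq))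
    fnK-H i (mixed _ ¬q) p = contradiction (_ , p , refl) ¬q

    ixK-H : ∀ {hs} (k : Kind (Vec.map (E σ) hs)) → All H hs → x.ix hs ≡ ixK k
    ixK-H {hs} (old p) _ =
      let gs = All-pull dom-E p in trans (R.e-ix gs) (cong ix (sym (map-E-old gs)))
    ixK-H (inH _ (hs′ , _ , eq)) _ = cong x.ix (sym (map-E-injective eq))
    ixK-H (mixed _ ¬q) p = contradiction (_ , p , refl) ¬q

    fnK-mixed : ∀ {i as} (k : Kind as) → ¬ All dom as → ¬ InH as → dom⁺ i → Below as i → fnK k i ≡ i
    fnK-mixed (old p)   ¬p _ _ _ = contradiction p ¬p
    fnK-mixed (inH _ q) _ ¬q _ _ = contradiction q ¬q
    fnK-mixed {i} {as} (mixed _ _) _ _ i∈ below with dec (dom⁺ i × Below as i)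
    ... | yes _ = refl
    ... | no ¬p = contradiction (i∈ , λ {τ} → below {τ}) ¬p

    first-All : ∀ {P : Pred ℕ 0ℓ} {as : Tuple} → All P as → P (first as)
    first-All (p ∷ _) = p

    closedK : ∀ i {as} (k : Kind as) → All dom⁺ as → dom⁺ (fnK k i)
    closedK i (old p)                 _ = inj₁ (closed i p)
    closedK i (inH _ (hs , hs∈ , _)) _ = inj₂ (_ , app i hs∈ , refl)
    closedK i {as} (mixed _ _) as∈ with dec (dom⁺ i × Below as i)
    ... | yes (i∈ , _) = i∈
    ... | no _         = first-All as∈

    trivK : ∀ {i as} (k : Kind as) → i > ixK k → fnK k i ≡ first as
    trivK (old p) i> = triv p i>
    trivK {as = as} (inH _ (hs , _ , eq)) i> =
      trans (cong (E σ) (x.fn-trivial hs i>)) (trans (sym (first-map (E σ) hs)) (cong first eq))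
    trivK {i} {as} (mixed _ _) i> with dec (dom⁺ i × Below as i)
    ... | yes (i∈ , _) = contradiction (dom⁺<c⁺ i∈) (<-asym i>)
    ... | no _         = refl

    All-old : ∀ {τ n} {as : Vec ℕ n} → All dom as → All (λ a → t⁺ a ⊆ˢ τ) as → All (λ a → t a ⊆ˢ τ) as
    All-old [] [] = []
    All-old {τ} (p ∷ ps) (q ∷ qs) = subst (_⊆ˢ τ) (t⁺-old p) q ∷ All-old ps qs

    -- Some entry is new, and new elements have support `σ`. Hence values at tuples of `H`, having
    -- support inside `σ`, respect `supp`.
    ¬old⇒σ⊆ : ∀ {τ n} {as : Vec ℕ n} → ¬ All dom as → All (λ a → t⁺ a ⊆ˢ τ) as → σ ⊆ˢ τ
    ¬old⇒σ⊆ ¬p [] = contradiction [] ¬p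
    ¬old⇒σ⊆ {τ} {as = a ∷ as} ¬p (q ∷ qs) with dec (dom a)
    ... | yes a∈ = ¬old⇒σ⊆ (λ p → ¬p (a∈ ∷ p)) qs
    ... | no a∉  = q

    suppK : ∀ i {as} (k : Kind as) {τ} → All (λ a → t⁺ a ⊆ˢ τ) as → t⁺ (fnK k i) ⊆ˢ τ
    suppK i (old p) {τ} qs = subst (_⊆ˢ τ) (sym (t⁺-old (closed i p))) (supp i p (All-old p qs))
    suppK i (inH ¬p _) qs = λ z∈ → ¬old⇒σ⊆ ¬p qs (t⁺-E z∈)
    suppK i {as} (mixed _ _) {τ} qs with dec (dom⁺ i × Below as i)
    ... | yes (_ , below) = below {τ} qs
    ... | no _            = first-All qs

    depend-old : ∀ {b : Fin (suc (suc d)) → ℕ} → Injective _≡_ _≡_ b → (∀ j → dom (b j)) →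
                 Dependent (str fn⁺) b
    depend-old b-inj b∈dom = Dependent-transfer (str fn) (str fn⁺) (λ a b → dom a × a ≡ b)
      (λ { f rs → let as∈ , eq = diagonal⇒≡ rs in
           closed f as∈ , trans (fnK-old f (kind _) as∈) (cong (fn⁺ f) eq) })
      (λ (_ , eq) (_ , eq′) → trans (sym eq) eq′) (λ j → b∈dom j , refl) (depend b-inj b∈dom)

    depend-H : ∀ {b : Fin (suc (suc d)) → ℕ} → Injective _≡_ _≡_ b → (∀ j → N (b j)) →
               Dependent (str fn⁺) b
    depend-H b-inj b∈N = Dependent-transfer (str x.fn) (str fn⁺) (λ h z → H h × E σ h ≡ z)
      (λ { f rs → let hs∈ , eq = graph⇒map rs in
           app f hs∈ , trans (fnK-H f (kind _) hs∈) (cong (fn⁺ f) eq) })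
      (λ (_ , eq) (_ , eq′) → trans (sym eq) eq′) (λ j → proj₂ (b∈N j))
      (x.dependent-str λ {i} {j} eq → b-inj
        (trans (sym (proj₂ (proj₂ (b∈N i)))) (trans (cong (E σ) eq) (proj₂ (proj₂ (b∈N j))))))

    InH⇒All-N : ∀ {n} {as : Vec ℕ n} → InH as → All N as
    InH⇒All-N (_ , hs∈ , refl) = map⁺ (All.map (λ h∈ → _ , h∈ , refl) hs∈)

    -- An old element with empty support belongs to the part of `σ`, which `e σ` covers, and hence
    -- to `N`.
    old-support : ∀ {z} → dom z → ¬ N z → ∃ λ c₀ → c₀ ∈ˢ t⁺ z
    old-support {z} z∈ z∉N = by-contradiction λ none →
      let h , g , eq = covered z∈
            (λ c∈ → contradiction (_ , subst (_ ∈ˢ_) (sym (t⁺-old z∈)) c∈) none)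
      in z∉N (h , G⇒H g , trans (E-old g) eq)

    -- `redundant` omits a member `i` other than `u` and `v`. The remaining tuple still contains
    -- `b u` and `b v`, so it is mixed, and its supports cover that of `b i`; symbol number `b i`
    -- therefore returns `b i`.
    depend-mixed : ∀ {b : Fin (suc (suc d)) → ℕ} → (∀ j → dom⁺ (b j)) →
                   ∀ {u v} → ¬ dom (b u) → ¬ N (b v) → Dependent (str fn⁺) b
    depend-mixed {b} b∈ {u} {v} u∉dom v∉N with b∈ v
    ... | inj₂ v∈N   = contradiction v∈N v∉N
    ... | inj₁ v∈dom with redundant (t⁺ ∘ b) u v (proj₂ (old-support v∈dom v∉N))
    ...   | i , i≢u , i≢v , cover = dependent-by (str fn⁺) i (b i) (fnK-mixed (kind (others b i))
      (λ p → u∉dom (others⁻ {b = b} {P = dom} p (i≢u ∘ sym)))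
      (λ q → v∉N (others⁻ {b = b} {P = N} (InH⇒All-N q) (i≢v ∘ sym)))
      (b∈ i)
      (λ {τ} qs {c} c∈ → let j , j≢i , c∈j = cover c∈ in
        others⁻ {b = b} {P = λ a → t⁺ a ⊆ˢ τ} qs j≢i c∈j))

    depend⁺ : ∀ {b : Fin (suc (suc d)) → ℕ} → Injective _≡_ _≡_ b → (∀ j → dom⁺ (b j)) →
              Dependent (str fn⁺) b
    depend⁺ {b} b-inj b∈ = case-split (dec _) (dec _)
      where
      case-split : Dec (∀ j → dom (b j)) → Dec (∀ j → N (b j)) → Dependent (str fn⁺) b
      case-split (yes b∈dom) _         = depend-old b-inj b∈dom
      case-split (no _)      (yes b∈N) = depend-H b-inj b∈N
      case-split (no b∉dom)  (no b∉N)  =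
        depend-mixed {b} b∈ (proj₂ (¬∀⇒∃¬ b∉dom)) (proj₂ (¬∀⇒∃¬ b∉N))

    G⁺ : Subset d → Pred ℕ 0ℓ
    G⁺ τ h = G τ h ⊎ (σ ≡ τ × H h)

    amalgam : State
    amalgam = record
      { dom = dom⁺ ; fn = fn⁺ ; ix = ix⁺ ; t = t⁺ ; lab = lab⁺ ; m = M ; G = G⁺ ; e = E ; c = c⁺
      ; κ      = λ τ → κ τ ⊔ B
      ; dom<c  = dom⁺<c⁺
      ; closed = λ i as∈ → closedK i (kind _) as∈
      ; triv   = λ _ i> → trivK (kind _) i>
      ; supp   = λ i _ {τ} qs → suppK i (kind _) {τ} qs
      ; depend = depend⁺
      ; G<κ    = λ { {τ} (inj₁ g)          → <-≤-trans (G<κ g) (m≤m⊔n (κ τ) B)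
                   ; {τ} (inj₂ (_ , h∈)) → <-≤-trans (H<B h∈) (m≤n⊔m (κ τ) B) }
      ; e-dom  = λ { (inj₁ g)            → inj₁ (subst dom (sym (E-old g)) (e-dom g))
                   ; (inj₂ (refl , h∈)) → inj₂ (_ , h∈ , refl) }
      ; e-supp = λ { {τ} (inj₁ g)       → subst (_⊆ˢ τ)
                       (sym (trans (cong t⁺ (E-old g)) (t⁺-old (e-dom g)))) (e-supp g)
                   ; {h = h} (inj₂ (refl , _)) → t⁺-E {h} }
      ; e-inj  = λ {τ} _ _ → E-injective {τ}
      }

    ≼-amalgam : S ≼ amalgam
    ≼-amalgam = record
      { dom⊆ = inj₁
      ; fn≡  = λ i as∈ → fnK-old i (kind _) as∈
      ; ix≡  = λ as∈ → ixK-old (kind _) as∈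
      ; t≡   = λ z∈ → sym (t⁺-old z∈)
      ; lab≡ = lab⁺-old
      ; m≤   = m≤M
      ; G⊆   = inj₁
      ; e≡   = λ g → sym (E-old g)
      }

    amalgam-realized : Realized amalgam σ x H M
    amalgam-realized = record
      { M≤m      = ≤-refl
      ; H⊆G      = λ h∈ → inj₂ (refl , h∈)
      ; x-closed = λ i hs∈ → app i hs∈
      ; e-fn     = λ i hs∈ → fnK-H i (kind _) hs∈
      ; e-ix     = λ hs∈ → ixK-H (kind _) hs∈
      ; e-lab    = λ h∈ _ → lab⁺-N h∈
      }

    amalgam-covers : ∀ {z} → dom z → t z ⊆ˢ σ → ∃ λ h → H h × E σ h ≡ z
    amalgam-covers z∈ z⊆σ = let h , g , eq = covered z∈ z⊆σ in h , G⇒H g , trans (E-old g) eq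

    -- The place `κ σ` is below `K` but not in `G σ`, so it gives a new element. This element later
    -- shows that the cube reflects arrows.
    amalgam-fresh : ∃ λ h → H h × t⁺ (E σ h) ≡ σ
    amalgam-fresh = κ σ , gen κ<K , t⁺-new (λ z∈ → <-irrefl refl (G<κ (dom-E z∈)))

  module Initial (x : Point) (K M : ℕ) where
    private module x = Pt x

    H : Pred ℕ 0ℓ
    H = Hull x K

    -- With all supports empty, all parts coincide at the start, and each is enumerated by the
    -- identity.
    initial : State
    initial = record
      { dom = H ; fn = x.fn ; ix = x.ix ; t = λ _ → ⊥ ; lab = x.lab ; m = M
      ; G = λ _ → H ; e = λ _ → id ; c = proj₁ (hull-bounded x K) ; κ = λ _ → proj₁ (hull-bounded x K)
      ; dom<c  = proj₂ (hull-bounded x K)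
      ; closed = λ i as∈ → app i as∈
      ; triv   = λ {_} {as} _ i> → x.fn-trivial as i>
      ; supp   = λ _ _ {τ} _ → ⊆-min τ
      ; depend = λ b-inj _ → x.dependent-str b-inj
      ; G<κ    = proj₂ (hull-bounded x K)
      ; e-dom  = id
      ; e-supp = λ {τ} _ → ⊆-min τ
      ; e-inj  = λ _ _ → id
      }

    initial-realized : ∀ σ → Realized initial σ x H M
    initial-realized σ = record
      { M≤m      = ≤-refl
      ; H⊆G      = id
      ; x-closed = λ i hs∈ → app i hs∈
      ; e-fn     = λ i {hs} _ → cong (x.fn i) (sym (map-id hs))
      ; e-ix     = λ {hs} _ → cong x.ix (sym (map-id hs))
      ; e-lab    = λ _ _ → refl
      }

  -- The generic cube

  collect : ∀ k {P : ℕ → ℕ → Set} → (∀ a → ∃ λ M → ∀ {M′} → M ≤ M′ → P a M′) →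
            ∃ λ M → ∀ {M′} → M ≤ M′ → ∀ {a} → a < k → P a M′
  collect zero    _ = 0 , λ _ ()
  collect (suc k) {P} f =
    let M , p = collect k f
        M₁ , p₁ = f k
    in M ⊔ M₁ , λ M≤ a<1+k → case-split (p (m⊔n≤o⇒m≤o M M₁ M≤)) (p₁ (m⊔n≤o⇒n≤o M M₁ M≤))
                               (m<1+n⇒m<n∨m≡n a<1+k)
    where
    case-split : ∀ {M a} → (∀ {a} → a < k → P a M) → P k M → a < k ⊎ a ≡ k → P a M
    case-split p pk (inj₁ a<k)  = p a<k
    case-split p pk (inj₂ refl) = pk

  distinguish : ∀ x B → ∃ λ M → ∀ {M′} → M ≤ M′ → ∀ {a} → a < B → ∀ {b} → b < B →
                (∀ i → i < M′ → Pt.lab x a i ≡ Pt.lab x b i) → a ≡ b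
  distinguish x B = collect B (λ a → collect B (λ b → pair a b (a ≟ b)))
    where
    pair : ∀ a b → Dec (a ≡ b) → ∃ λ M → ∀ {M′} → M ≤ M′ →
           (∀ i → i < M′ → Pt.lab x a i ≡ Pt.lab x b i) → a ≡ b
    pair a b (yes a≡b) = 0 , λ _ _ → a≡b
    pair a b (no a≢b)  =
      let i , differ = ¬∀⇒∃¬ (a≢b ∘ Pt.distinct x a b) in
      suc i , λ M≤ same → contradiction (same i M≤) differ

  -- What round `k` achieves for `σ`, where `S₀` is the state at the beginning of the round. By
  -- `task-≼` it survives in all later states with the same `x`, `H` and `M`.
  record Task (k : ℕ) (S₀ : State) (N : Pred Point 0ℓ) (σ : Subset d) (S : State) : Set₁ where
    field
      x        : Point
      H        : Pred ℕ 0ℓ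
      M        : ℕ
      realized : Realized S σ x H M
      below    : ∀ {h} → h < k → H h
      k≤M      : k ≤ M
      bounded  : ∃ λ B → ∀ {h} → H h → h < B
      avoids   : ∀ {y} → AgreeOn x y H M → ¬ N y
      covers   : ∀ {z} → State.dom S₀ z → State.t S₀ z ⊆ˢ σ → ∃ λ h → H h × State.e S σ h ≡ z
      fresh    : ∃ λ h → H h × State.t S (State.e S σ h) ≡ σ
      distinct : ∀ {a b} → H a → H b → (∀ i → i < M → Pt.lab x a i ≡ Pt.lab x b i) → a ≡ b

  task-≼ : ∀ {k S₀ N σ S S′} → S ≼ S′ → Task k S₀ N σ S → Task k S₀ N σ S′
  task-≼ {S = S} {S′} S≼S′ task = record
    { x = x ; H = H ; M = M ; realized = realized-≼ S≼S′ realized ; below = below ; k≤M = k≤M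
    ; bounded = bounded ; avoids = λ {y} → avoids {y} ; distinct = distinct
    ; covers = λ z∈ z⊆σ → let h , h∈ , eq = covers z∈ z⊆σ in
        h , h∈ , trans (sym (_≼_.e≡ S≼S′ (H⊆G h∈))) eq
    ; fresh  = let h , h∈ , eq = fresh in
        h , h∈ , trans (cong (State.t S′) (sym (_≼_.e≡ S≼S′ (H⊆G h∈))))
                   (trans (sym (_≼_.t≡ S≼S′ (State.e-dom S (H⊆G h∈)))) eq)
    }
    where
    open Task task
    open Realized realized using (H⊆G)

  module Step (k : ℕ) (S₀ : State) {N : Pred Point 0ℓ} (nd : NowhereDense N) where

    abstract
      -- The part of `σ` is completed to a point, this is moved to a nearby `x` with a neighbourhood
      -- disjoint from `N`, and a finite substructure of `x` deciding that neighbourhood is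
      -- amalgamated back into the state.
      perform : ∀ σ S → S₀ ≼ S → ∃ λ S′ → S ≼ S′ × Task k S₀ N σ S′
      perform σ S S₀≼S = A.amalgam , ≼-trans C.≼-cover A.≼-amalgam , record
        { x        = x
        ; H        = Hull x K
        ; M        = M
        ; realized = A.amalgam-realized
        ; below    = λ h<k → gen (<-≤-trans h<k (≤-trans (m≤m⊔n k kb) (m≤n⊔m (suc κ) (k ⊔ kb))))
        ; k≤M      = ≤-trans (m≤m⊔n k kb) (≤-trans (m≤m⊔n (k ⊔ kb) Md) (m≤n⊔m m (k ⊔ kb ⊔ Md)))
        ; bounded  = hull-bounded x K
        ; avoids   = λ {y} ag → proj₂ (proj₂ (proj₂ (proj₂ near))) {y} (proj₂ determined {y}
            (≤-trans (m≤n⊔m k kb) (≤-trans (m≤m⊔n (k ⊔ kb) Md) (m≤n⊔m m (k ⊔ kb ⊔ Md))))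
            (λ a<kb → gen (<-≤-trans a<kb (≤-trans (m≤n⊔m k kb) (m≤n⊔m (suc κ) (k ⊔ kb))))) ag)
        ; covers   = λ {z} z∈ z⊆σ → A.amalgam-covers (_≼_.dom⊆ S₀≼S z∈)
            (subst (_⊆ˢ σ) (_≼_.t≡ S₀≼S z∈) z⊆σ)
        ; fresh    = A.amalgam-fresh
        ; distinct = λ a∈ b∈ → proj₂ separated
            (≤-trans (m≤n⊔m (k ⊔ kb) Md) (m≤n⊔m m (k ⊔ kb ⊔ Md)))
            (proj₂ (hull-bounded x K) a∈) (proj₂ (hull-bounded x K) b∈)
        }
        where
        module C = Cover S
        S₁ : State
        S₁ = C.cover
        module X = Extend S₁ σ C.covered
        κ m : ℕ
        κ = State.κ S₁ σ
        m = State.m S₁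
        near : ∃ λ x → AgreeOn x X.extension (_< κ) m ×
               ∃ λ is → x ∈ basic is × (∀ {z} → z ∈ basic is → ¬ N z)
        near = avoid {N} {X.extension} {λ x → AgreeOn x X.extension (_< κ) m}
                 (λ V → nd V) (agree-nbhd X.extension κ m)
        x : Point
        x = proj₁ near
        is : List (StructureIndex (hat (ℒ (suc d))))
        is = proj₁ (proj₂ (proj₂ near))
        determined : ∃ λ k → ∀ {y H M} → k ≤ M → (∀ {a} → a < k → H a) →
                     AgreeOn x y H M → y ∈ basic is
        determined = basic-determined x is (proj₁ (proj₂ (proj₂ (proj₂ near))))
        kb K : ℕ
        kb = proj₁ determined
        -- `suc κ` provides the fresh element, `k` makes the enumeration progress, and `kb` decides
        -- the neighbourhood.
        K = suc κ ⊔ (k ⊔ kb)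
        separated : ∃ λ M → ∀ {M′} → M ≤ M′ → ∀ {a} → a < proj₁ (hull-bounded x K) →
                    ∀ {b} → b < proj₁ (hull-bounded x K) →
                    (∀ i → i < M′ → Pt.lab x a i ≡ Pt.lab x b i) → a ≡ b
        separated = distinguish x (proj₁ (hull-bounded x K))
        Md M : ℕ
        Md = proj₁ separated
        -- As for `K`, but above the old `m`; `Md` is enough labels to separate the elements of the
        -- hull.
        M = m ⊔ (k ⊔ kb ⊔ Md)
        module A = Amalgam S₁ σ C.covered x (X.close-realized {x} (proj₁ (proj₂ near)))
          K (m≤m⊔n (suc κ) (k ⊔ kb)) M (m≤m⊔n m (k ⊔ kb ⊔ Md))

  forall-subsets : ∀ {j} (S₀ : State) (P : Subset j → State → Set₁) →
    (∀ {σ S S′} → S ≼ S′ → P σ S → P σ S′) →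
    (∀ σ S → S₀ ≼ S → ∃ λ S′ → S ≼ S′ × P σ S′) →
    ∀ S → S₀ ≼ S → ∃ λ S′ → S ≼ S′ × (∀ σ → P σ S′)
  forall-subsets {zero} S₀ P persist perform S S₀≼S =
    let S′ , S≼S′ , p = perform [] S S₀≼S in S′ , S≼S′ , λ { [] → p }
  forall-subsets {suc j} S₀ P persist perform S S₀≼S =
    let S₁ , S≼S₁ , p  = forall-subsets S₀ (P ∘ (inside ∷_)) persist (perform ∘ (inside ∷_)) S S₀≼S
        S₂ , S₁≼S₂ , q = forall-subsets S₀ (P ∘ (outside ∷_)) persist (perform ∘ (outside ∷_))
                           S₁ (≼-trans S₀≼S S≼S₁)
    in S₂ , ≼-trans S≼S₁ S₁≼S₂ , λ { (inside ∷ σ) → persist S₁≼S₂ (p σ) ; (outside ∷ σ) → q σ }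

  module Limit (x₀ : Point) (is₀ : List (StructureIndex (hat (ℒ (suc d)))))
    (x₀∈is₀ : x₀ ∈ basic is₀) (N : ℕ → Pred Point 0ℓ) (nd : ∀ k → NowhereDense (N k)) where

    k₀ : ℕ
    k₀ = proj₁ (basic-determined x₀ is₀ x₀∈is₀)

    round : ∀ k S → ∃ λ S′ → S ≼ S′ × (∀ σ → Task k S (N k) σ S′)
    round k S =
      forall-subsets S (Task k S (N k)) task-≼ (Step.perform k S (λ V → nd k V)) S ≼-refl

    abstract
      seq : ℕ → State
      seq zero    = Initial.initial x₀ k₀ k₀
      seq (suc k) = proj₁ (round k (seq k))

      seq-≼ : ∀ {j k} → j ≤ k → seq j ≼ seq k
      seq-≼ = go ∘ ≤⇒≤′
        where
        go : ∀ {j k} → j ≤′ k → seq j ≼ seq k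
        go (≤′-reflexive refl) = ≼-refl
        go (≤′-step {k} j≤k)   = ≼-trans (go j≤k) (proj₁ (proj₂ (round k (seq k))))

      start : ∀ σ → Realized (seq 0) σ x₀ (Hull x₀ k₀) k₀
      start = Initial.initial-realized x₀ k₀ k₀

      task : ∀ k σ → Task k (seq k) (N k) σ (seq (suc k))
      task k = proj₂ (proj₂ (round k (seq k)))

    module Tk k σ = Task (task k σ)

    realized : ∀ {k σ L} → suc k ≤ L → Realized (seq L) σ (Tk.x k σ) (Tk.H k σ) (Tk.M k σ)
    realized {k} {σ} k<L = realized-≼ (seq-≼ k<L) (Tk.realized k σ)

    -- Round a + 1 enumerates all places up to `a`, and its outcome is state a + 2.
    ∈G : ∀ {σ a L} → suc (suc a) ≤ L → State.G (seq L) σ a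
    ∈G {σ} {a} a< = Realized.H⊆G (realized {suc a} {σ} a<) (Tk.below (suc a) σ (n<1+n a))

    E : Subset d → ℕ → ℕ
    E σ a = State.e (seq (suc (suc a))) σ a

    e≡E : ∀ {L σ a} → State.G (seq L) σ a → State.e (seq L) σ a ≡ E σ a
    e≡E {L} {σ} {a} g =
      trans (_≼_.e≡ (seq-≼ (m≤m⊔n L (suc (suc a)))) g)
            (sym (_≼_.e≡ (seq-≼ (m≤n⊔m L (suc (suc a)))) (∈G ≤-refl)))

    map-e≡E : ∀ {L σ n} {as : Vec ℕ n} → All (State.G (seq L) σ) as →
              Vec.map (State.e (seq L) σ) as ≡ Vec.map (E σ) as
    map-e≡E = map-cong-All e≡E

    E-injective : ∀ {σ a b} → E σ a ≡ E σ b → a ≡ b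
    E-injective {σ} {a} {b} eq =
      State.e-inj (seq L) ga gb (trans (e≡E ga) (trans eq (sym (e≡E gb))))
      where
      L = suc (suc a) ⊔ suc (suc b)
      ga : State.G (seq L) σ a
      ga = ∈G (m≤m⊔n (suc (suc a)) (suc (suc b)))
      gb : State.G (seq L) σ b
      gb = ∈G (m≤n⊔m (suc (suc a)) (suc (suc b)))

    E-dom : ∀ {σ a L} → suc (suc a) ≤ L → State.dom (seq L) (E σ a)
    E-dom {L = L} a< = subst (State.dom (seq L)) (e≡E (∈G a<)) (State.e-dom (seq L) (∈G a<))

    E-supp : ∀ {σ a L} → suc (suc a) ≤ L → State.t (seq L) (E σ a) ⊆ˢ σ
    E-supp {σ} {L = L} a< =
      subst (λ z → State.t (seq L) z ⊆ˢ σ) (e≡E (∈G a<)) (State.e-supp (seq L) (∈G a<))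

    module _ {L σ x H M} (r : Realized (seq L) σ x H M) where
      open Realized r

      E-fn : ∀ i {as} → All H as → E σ (Pt.fn x i as) ≡ State.fn (seq L) i (Vec.map (E σ) as)
      E-fn i as∈ = trans (sym (e≡E (H⊆G (x-closed i as∈)))) (trans (e-fn i as∈)
        (cong (State.fn (seq L) i) (map-e≡E (All.map H⊆G as∈))))

      E-ix : ∀ {as} → All H as → Pt.ix x as ≡ State.ix (seq L) (Vec.map (E σ) as)
      E-ix as∈ = trans (e-ix as∈) (cong (State.ix (seq L)) (map-e≡E (All.map H⊆G as∈)))

      E-lab : ∀ {a i} → H a → i < M → Pt.lab x a i ≡ State.lab (seq L) (E σ a) i
      E-lab {i = i} a∈ i<M = trans (e-lab a∈ i<M) (cong (λ z → State.lab (seq L) z i) (e≡E (H⊆G a∈)))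

    module _ (σ : Subset d) where

      -- Read off at round `bound as`, whose `H` contains all entries; `yfn-agrees` makes the choice
      -- of the round immaterial.
      yfn : ℕ → Tuple → ℕ
      yfn i as = Pt.fn (Tk.x (bound as) σ) i as

      yix : Tuple → ℕ
      yix as = Pt.ix (Tk.x (bound as) σ) as

      ylab : ℕ → ℕ → Bool
      ylab a i = Pt.lab (Tk.x (suc (a ⊔ i)) σ) a i

      bound∈H : ∀ {n} (as : Vec ℕ n) → All (Tk.H (bound as) σ) as
      bound∈H as = All.map (λ {a} → Tk.below (bound as) σ) (<bound as)

      yfn-E : ∀ {L} i as → bound as < L → E σ (yfn i as) ≡ State.fn (seq L) i (Vec.map (E σ) as)
      yfn-E i as as<L = E-fn (realized as<L) i (bound∈H as)

      yix-E : ∀ {L} as → bound as < L → yix as ≡ State.ix (seq L) (Vec.map (E σ) as)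
      yix-E as as<L = E-ix (realized as<L) (bound∈H as)

      ylab-E : ∀ {L a i} → suc (a ⊔ i) < L → ylab a i ≡ State.lab (seq L) (E σ a) i
      ylab-E {L} {a} {i} <L = E-lab (realized {suc (a ⊔ i)} <L)
        (Tk.below (suc (a ⊔ i)) σ (s≤s (m≤m⊔n a i)))
        (<-≤-trans (s≤s (m≤n⊔m a i)) (Tk.k≤M (suc (a ⊔ i)) σ))

      module _ {k x H M} (r : Realized (seq k) σ x H M) where

        -- Both values have the same image under `E σ`, computed in a common later state.
        yfn-agrees : ∀ i {as} → All H as → Pt.fn x i as ≡ yfn i as
        yfn-agrees i {as} as∈ = E-injective
          (trans (E-fn (realized-≼ (seq-≼ (m≤m⊔n k (suc (bound as)))) r) i as∈)
                 (sym (yfn-E i as (m≤n⊔m k (suc (bound as))))))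

        yix-agrees : ∀ {as} → All H as → Pt.ix x as ≡ yix as
        yix-agrees {as} as∈ =
          trans (E-ix (realized-≼ (seq-≼ (m≤m⊔n k (suc (bound as)))) r) as∈)
                (sym (yix-E as (m≤n⊔m k (suc (bound as)))))

        ylab-agrees : ∀ {a i} → H a → i < M → Pt.lab x a i ≡ ylab a i
        ylab-agrees {a} {i} a∈ i<M =
          trans (E-lab (realized-≼ (seq-≼ (m≤m⊔n k (suc (suc (a ⊔ i))))) r) a∈ i<M)
                (sym (ylab-E {k ⊔ suc (suc (a ⊔ i))} {a} {i} (m≤n⊔m k (suc (suc (a ⊔ i))))))

      ystr : Structure (ℒ (suc d)) ℕ
      ystr = reduct (structure yfn yix ylab)

      y-dependent : (b : Fin (suc (suc d)) → ℕ) → Injective _≡_ _≡_ b → Dependent ystr b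
      y-dependent b b-inj = Dependent-transfer (str (Pt.fn (Tk.x k σ))) ystr
        (λ a b → Tk.H k σ a × a ≡ b)
        (λ { f rs → let as∈ , eq = diagonal⇒≡ rs in
             Realized.x-closed (Tk.realized k σ) f as∈ ,
             trans (yfn-agrees (Tk.realized k σ) f as∈) (cong (yfn f) eq) })
        (λ (_ , eq) (_ , eq′) → trans (sym eq) eq′)
        (λ j → Tk.below k σ (tabulate⁻ {f = b} (<bound (Vec.tabulate b)) j) , refl)
        (Pt.dependent-str (Tk.x k σ) b-inj)
        where k = bound (Vec.tabulate b)

      -- (B3), (B4) and separation by labels are inherited from the finite closed set `H` of a
      -- single late round.
      limit : Point
      limit = point yfn yix ylab
        (λ as → Pt.fn-trivial (Tk.x (bound as) σ) as)
        y-dependent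
        (λ k → proj₁ (Tk.bounded k σ) , λ p → proj₂ (Tk.bounded k σ)
          (Generated-least {M = ystr}
            (λ f as∈ → subst (Tk.H k σ) (yfn-agrees (Tk.realized k σ) f as∈)
                         (Realized.x-closed (Tk.realized k σ) f as∈))
            (Tk.below k σ) p))
        (λ a b same →
          let k    = suc (a ⊔ b)
              real = Tk.realized k σ
              a∈   = Tk.below k σ (s≤s (m≤m⊔n a b))
              b∈   = Tk.below k σ (s≤s (m≤n⊔m a b))
          in Tk.distinct k σ a∈ b∈ λ i i<M → trans (ylab-agrees real a∈ i<M)
               (trans (same i) (sym (ylab-agrees real b∈ i<M))))

      limit-agrees : ∀ {k x H M} → Realized (seq k) σ x H M → AgreeOn x limit H M
      limit-agrees {x = x} r = record
        { fn≡  = λ i → yfn-agrees {x = x} r i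
        ; ix≡  = yix-agrees {x = x} r
        ; lab≡ = ylab-agrees {x = x} r
        }

      limit∈is₀ : limit ∈ basic is₀
      limit∈is₀ = proj₂ (basic-determined x₀ is₀ x₀∈is₀) {limit} ≤-refl gen
        (limit-agrees {x = x₀} (start σ))

      limit∉N : ∀ k → ¬ N k limit
      limit∉N k = Tk.avoids k σ {limit} (limit-agrees {x = Tk.x k σ} (Tk.realized k σ))

    E-onto : ∀ {k τ z} → State.dom (seq k) z → State.t (seq k) z ⊆ˢ τ → ∃ λ b → E τ b ≡ z
    E-onto {k} {τ} z∈ z⊆τ =
      let b , b∈ , eq = Tk.covers k τ z∈ z⊆τ in
      b , trans (sym (e≡E (Realized.H⊆G (Tk.realized k τ) b∈))) eq

    module _ {σ τ} (φ : ℕ → ℕ) (Eφ : ∀ a → E τ (φ a) ≡ E σ a) where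

      map-Eφ : ∀ {n} (as : Vec ℕ n) → Vec.map (E τ) (Vec.map φ as) ≡ Vec.map (E σ) as
      map-Eφ []       = refl
      map-Eφ (a ∷ as) = cong₂ _∷_ (Eφ a) (map-Eφ as)

      φ-fn : ∀ i as → φ (yfn σ i as) ≡ yfn τ i (Vec.map φ as)
      φ-fn i as = E-injective (trans (Eφ _)
        (trans (yfn-E σ {L} i as (m≤m⊔n (suc (bound as)) (suc (bound (Vec.map φ as)))))
        (trans (cong (State.fn (seq L) i) (sym (map-Eφ as)))
               (sym (yfn-E τ i (Vec.map φ as) (m≤n⊔m (suc (bound as)) _))))))
        where L = suc (bound as) ⊔ suc (bound (Vec.map φ as))

      φ-ix : ∀ as → yix σ as ≡ yix τ (Vec.map φ as)
      φ-ix as =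
        trans (yix-E σ {L} as (m≤m⊔n (suc (bound as)) (suc (bound (Vec.map φ as)))))
        (trans (cong (State.ix (seq L)) (sym (map-Eφ as)))
               (sym (yix-E τ (Vec.map φ as) (m≤n⊔m (suc (bound as)) _))))
        where L = suc (bound as) ⊔ suc (bound (Vec.map φ as))

      φ-lab : ∀ a i → ylab σ a i ≡ ylab τ (φ a) i
      φ-lab a i =
        trans (ylab-E σ {L} {a} {i} (m≤m⊔n (suc (suc (a ⊔ i))) (suc (suc (φ a ⊔ i)))))
        (trans (cong (λ z → State.lab (seq L) z i) (sym (Eφ a)))
               (sym (ylab-E τ {L} {φ a} {i} (m≤n⊔m (suc (suc (a ⊔ i))) _))))
        where L = suc (suc (a ⊔ i)) ⊔ suc (suc (φ a ⊔ i))

      φ-rel : ∀ R as → rel (proj₁ (limit σ)) R as ≡ rel (proj₁ (limit τ)) R (Vec.map φ as)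
      φ-rel (inj₁ j) as       = cong (j ≡ᵇ_) (φ-ix as)
      φ-rel (inj₂ i) (a ∷ []) = φ-lab a i

      φ-↪ : proj₁ (limit σ) ↪ proj₁ (limit τ)
      φ-↪ = record
        { embed     = φ
        ; injective = λ {a} {b} eq → E-injective (trans (sym (Eφ a)) (trans (cong (E τ) eq) (Eφ b)))
        ; fun-hom   = φ-fn
        ; rel-hom   = φ-rel
        }

    ⊆⇒factor : ∀ {σ τ} → σ ⊆ˢ τ → ∀ a → ∃ λ b → E τ b ≡ E σ a
    ⊆⇒factor {σ} {τ} σ⊆τ a = E-onto (E-dom {σ} {a} ≤-refl) (λ c∈ → σ⊆τ (E-supp {σ} {a} ≤-refl c∈))

    ⊆⇒↪ : ∀ {σ τ} → σ ⊆ˢ τ → proj₁ (limit σ) ↪ proj₁ (limit τ)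
    ⊆⇒↪ σ⊆τ = φ-↪ (λ a → proj₁ (⊆⇒factor σ⊆τ a)) (λ a → proj₂ (⊆⇒factor σ⊆τ a))

    -- Inside limit ⊤ an element is determined by its labels, so that an embedding of
    -- limit σ into limit τ fixes the element whose support is exactly σ.
    ↪⇒⊆ : ∀ {σ τ} → proj₁ (limit σ) ↪ proj₁ (limit τ) → σ ⊆ˢ τ
    ↪⇒⊆ {σ} {τ} F = subst (_⊆ˢ τ) t≡σ
      (subst (λ z → State.t (seq L) z ⊆ˢ τ) (sym same) (E-supp {τ} {φa} (m≤n⊔m 1 (suc (suc φa)))))
      where
      open _↪_ F
      fresh = Tk.fresh 0 σ
      a φa L : ℕ
      a = proj₁ fresh
      φa = embed a
      L = 1 ⊔ suc (suc φa)
      a∈G : State.G (seq 1) σ a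
      a∈G = Realized.H⊆G (Tk.realized 0 σ) (proj₁ (proj₂ fresh))
      t≡σ : State.t (seq L) (E σ a) ≡ σ
      t≡σ = trans (sym (_≼_.t≡ (seq-≼ (m≤m⊔n 1 (suc (suc φa))))
                    (subst (State.dom (seq 1)) (e≡E a∈G) (State.e-dom (seq 1) a∈G))))
              (trans (cong (State.t (seq 1)) (sym (e≡E a∈G))) (proj₂ (proj₂ fresh)))
      σ⇒⊤ = ⊆⇒factor (⊆-max σ)
      τ⇒⊤ = ⊆⇒factor (⊆-max τ)
      same : E σ a ≡ E τ φa
      same = trans (sym (proj₂ (σ⇒⊤ a))) (trans (cong (E ⊤)
        (↪-unique {y = limit ⊤} (⊆⇒↪ (⊆-max σ)) (↪-trans F (⊆⇒↪ (⊆-max τ))) a)) (proj₂ (τ⇒⊤ φa)))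

  -- Orbits, cubes and the dimension

  abstract
    generic-cube : ∀ {x is} → x ∈ basic is → (N : ℕ → Pred Point 0ℓ) → (∀ k → NowhereDense (N k)) →
      ∃ λ (f : Subset d → Point) →
        (∀ σ → f σ ∈ basic is × (∀ k → ¬ N k (f σ))) ×
        (∀ σ τ → σ ⊆ˢ τ → RightEmbeds (f σ) (f τ)) ×
        (∀ σ τ → RightEmbeds (f σ) (f τ) → σ ⊆ˢ τ)
    generic-cube {x} {is} x∈is N nd =
      L.limit
      , (λ σ → L.limit∈is₀ σ , L.limit∉N σ)
      , (λ σ τ σ⊆τ → from-↪ {L.limit σ} {L.limit τ} (L.⊆⇒↪ σ⊆τ))
      , (λ σ τ r → L.↪⇒⊆ (to-↪ {L.limit σ} {L.limit τ} r))
      where module L = Limit x is x∈is N (λ k V → nd k V)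

    sameOrbit-refl : ∀ x → SameOrbit x x
    sameOrbit-refl (M , _) = ↔-id ℕ , (λ f as → cong (fun M f) (map-id as))
                                    , (λ R as → cong (rel M R) (map-id as))

    sameOrbit⇒rightEmbeds : ∀ x y → SameOrbit x y → RightEmbeds x y
    sameOrbit⇒rightEmbeds x y (g , fun≡ , rel≡) = from-↪ {x} {y} record
      { embed     = to g
      ; injective = to-injective g
      ; fun-hom   = λ f as → trans (cong (to g ∘ fun (proj₁ x) f) (sym (map-from-to g as)))
                                   (fun≡ f (Vec.map (to g) as))
      ; rel-hom   = λ R as → trans (cong (rel (proj₁ x) R) (sym (map-from-to g as)))
                                   (rel≡ R (Vec.map (to g) as))
      }

    sameOrbit⇒rightEmbeds⁻ : ∀ x y → SameOrbit x y → RightEmbeds y x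
    sameOrbit⇒rightEmbeds⁻ x y (g , fun≡ , rel≡) = from-↪ {y} {x} record
      { embed     = from g
      ; injective = from-injective g
      ; fun-hom   = λ f as → trans (cong (from g) (sym (fun≡ f as))) (strictlyInverseʳ g _)
      ; rel-hom   = λ R as → sym (rel≡ R as)
      }

  cube-embeds : ∀ {C : Pred Point 0ℓ} (f : Subset d → Point) → (∀ σ → C (f σ)) →
    (∀ σ τ → σ ⊆ˢ τ → RightEmbeds (f σ) (f τ)) → (∀ σ τ → RightEmbeds (f σ) (f τ) → σ ⊆ˢ τ) →
    cube d EmbedsIn becker C
  cube-embeds f f∈C mono cancel = (λ σ → f σ , f∈C σ) , record
    { isOrderHomomorphism = record
      { cong = λ { {σ} refl → sameOrbit-refl (f σ) }
      ; mono = λ {σ} {τ} → mono σ τ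
      }
    ; injective = λ {σ} {τ} same → ⊆-antisym
        (cancel σ τ (sameOrbit⇒rightEmbeds (f σ) (f τ) same))
        (cancel τ σ (sameOrbit⇒rightEmbeds⁻ (f σ) (f τ) same))
    ; cancel    = λ {σ} {τ} → cancel σ τ
    }

  -- Extending the empty state yields a point, so the space is non-empty.
  standard : Point
  standard = Extend.extension empty ⊥ (λ ())
    where
    empty : State
    empty = record
      { dom = λ _ → Empty.⊥ ; fn = λ _ → first ; ix = λ _ → 0 ; t = λ _ → ⊥
      ; lab = λ _ _ → false ; m = 0
      ; G = λ _ _ → Empty.⊥ ; e = λ _ → id ; c = 0 ; κ = λ _ → 0
      ; dom<c = λ () ; closed = λ { i {_ ∷ _} (() ∷ _) } ; triv = λ _ _ → refl
      ; supp = λ { i {_ ∷ _} (() ∷ _) }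
      ; depend = λ _ b∈ → contradiction (b∈ zero) id
      ; G<κ = λ () ; e-dom = λ () ; e-supp = λ () ; e-inj = λ ()
      }

  -- `C` is comeager in a non-empty open set, so it contains a generic cube; `cube-bound` holds for
  -- every `C`.
  dimension : ∀ {C : Pred Point 0ℓ} {x is} → x ∈ basic is →
              (N : ℕ → Pred Point 0ℓ) → (∀ k → NowhereDense (N k)) →
              (∀ {y} → y ∈ basic is → (∀ k → ¬ N k y) → C y) → HasDimension C [ d ]
  dimension {C} {x} {is} x∈is N nd inC =
    let f , generic , mono , cancel = generic-cube {x} {is} x∈is N nd
        f∈C = λ σ → inC {f σ} (proj₁ (generic σ)) (proj₂ (generic σ))
    in (f ⊤ , f∈C ⊤) , cube-embeds {C} f f∈C mono cancel , cube-bound {C}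

  ∅-nowhereDense : NowhereDense (λ _ → Empty.⊥)
  ∅-nowhereDense V V-open V⊆ x x∈V = let _ , e , _ = V⊆ {x} x∈V V V-open x∈V in e

  U-dimension : HasDimension U [ d ]
  U-dimension = dimension {U} {standard} {[]} []ˡ (λ _ _ → Empty.⊥) (λ _ → ∅-nowhereDense) (λ _ _ → _)

  -- `generic-cube` also acts as the Baire category theorem: it yields a point outside the given
  -- nowhere dense sets.
  U-nonmeager : ¬ Meager U
  U-nonmeager (N , nd , U⊆) =
    let f , generic , _ = generic-cube {standard} {[]} []ˡ N nd
        k , f⊤∈N = U⊆ {f ⊤} _
    in proj₂ (generic ⊤) k f⊤∈N

  U-baire : BaireProperty U
  U-baire = U , (λ {x} _ → [] , []ˡ , _) , (λ _ _ → Empty.⊥) , (λ _ → ∅-nowhereDense) , λ where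
    (inj₁ (_ , ¬u)) → contradiction _ ¬u
    (inj₂ (_ , ¬u)) → contradiction _ ¬u

  -- If the open set `V` is empty, `C` is contained in the meager difference; otherwise `C` is
  -- comeager in `V`.
  locally-at-least : LocallyAtLeast [ d ]
  locally-at-least C _ nonmeager (V , V-open , N , nd , diff⊆) with dec (∃ V)
  ... | no V-empty = contradiction
    (N , nd , λ {x} x∈C → diff⊆ {x} (inj₁ (x∈C , λ x∈V → V-empty (x , x∈V)))) nonmeager
  ... | yes (x , x∈V) = [ d ] , dim , [ ≤-refl ]
    where
    nb = V-open {x} x∈V
    dim : HasDimension C [ d ]
    dim = dimension {C} {x} {proj₁ nb} (proj₁ (proj₂ nb)) N nd λ {y} y∈is y∉N →
      by-contradiction λ y∉C →
        let k , y∈N = diff⊆ {y} (inj₂ (proj₂ (proj₂ nb) y∈is , y∉C)) in y∉N k y∈N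

  -- The whole space is itself an invariant non-meager set with the Baire property, and its cubes
  -- are bounded by `d`.
  locally-generic-bound : ∀ k → LocallyAtLeast k → k ≤⁺ [ d ]
  locally-generic-bound k at-least with at-least U (λ _ _ → _) U-nonmeager U-baire
  ... | ⊤⁺ , (_ , none) , _ = contradiction (d , proj₂ U-dimension) none
  ... | [ j ] , (_ , emb , _) , [ i≤j ] = [ ≤-trans i≤j (cube-bound {U} j emb) ]

theorem10 : ExcludedMiddle (lsuc 0ℓ) → (n : ℕ) .{{_ : NonZero n}} →
    RawS∞Space.Dimensional (Mod-𝓑̂ n) [ n ∸ 1 ] ×
    RawS∞Space.LocallyGenericallyDimensional (Mod-𝓑̂ n) [ n ∸ 1 ]
theorem10 em (suc d) = U-dimension , locally-at-least , locally-generic-bound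
  where open Main em d
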